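{- Let $n$ and $m$ be positive integers. For all nonnegative integers $d_1,\dots,d_{n-1}$, \[ |\mathrm{SB}(n,m;d_1,\dots,d_{n-1})| = \left(1!\,2!\cdots (n-1)!\right)^m \cdot |\mathrm{YB}(n,m;d_1,\dots,d_{n-1})|, \] and consequently \[ |\mathrm{SB}(n,m)| = \left(1!\,2!\cdots (n-1)!\right)^m \cdot |\mathrm{YB}(n,m)|. \]
   Context: The shifted staircase of size $n$ is the set of cells $(i,j)$ (row $i$, column $j$) with $1\le i\le j\le n$; the cell $(i,i)$ is its $i$th diagonal cell. Take $m$ copies $\lambda^{(1)},\dots,\lambda^{(m)}$ (called pages) of the shifted staircase of size $n$, and for each $1\le i\le n$ identify the $i$th diagonal cells of all pages into one cell; the result has $n+m\binom n2$ cells. An $(n,m)$-Selberg book is a filling of these cells with the integers $1,2,\dots,n+m\binom n2$, each used exactly once, such that in each page, the entry of every cell $(i,j)$ with $i<j$ is larger than the entry of the $i$th diagonal cell and smaller than the entry of the $j$th diagonal cell. An $(n,m)$-Young book is an $(n,m)$-Selberg book in which, additionally, in each page the entries increase from left to right along each row and from top to bottom along each column. $\mathrm{SB}(n,m)$ and $\mathrm{YB}(n,m)$ denote the sets of $(n,m)$-Selberg books and $(n,m)$-Young books. If $e_i$ denotes the entry of the $i$th diagonal cell, $\mathrm{SB}(n,m;d_1,\dots,d_{n-1})$ (resp. $\mathrm{YB}(n,m;d_1,\dots,d_{n-1})$) is the set of $(n,m)$-Selberg (resp. Young) books with $d_i=e_{i+1}-e_i-1$ for $i=1,\dots,n-1$.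 -}

module Defs where

open import Level using (0ℓ)
open import Data.Nat using (ℕ; suc; pred; _+_; _*_; _≤_; _<_; _!)
open import Data.Nat.Combinatorics using (_C_)
open import Data.Fin as Fin using (Fin; inject₁)
open import Data.Fin.Properties using (_≟_; ≤∧≢⇒<)
open import Data.List using (applyUpTo)
open import Data.Nat.ListAction using (product)
open import Data.Product using (Σ; _×_; proj₁; ∃!)
open import Function.Bundles using (Inverse)
open import Relation.Binary.Bundles using (Setoid)
open import Relation.Binary.PropositionalEquality using (_≡_; setoid; _→-setoid_)
open import Relation.Nullary using (yes; no)
import Relation.Binary.Construct.On as On

-- The cells of m shifted staircases of size n after identifying the i-th
-- diagonal cells of all pages.  Rows and columns are numbered from 0.
data Cell (n m : ℕ) : Set where
  diag : Fin n → Cell n m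
  off  : Fin m → (i j : Fin n) → i Fin.< j → Cell n m

-- The cell of the book onto which cell (i , j) of the page p is identified.
page : ∀ {n m} → Fin m → (i j : Fin n) → i Fin.≤ j → Cell n m
page p i j i≤j with i ≟ j
... | yes _   = diag i
... | no  i≢j = off p i j (≤∧≢⇒< i≤j i≢j)

numCells : ℕ → ℕ → ℕ
numCells n m = n + m * (n C 2)

record IsFilling (n m : ℕ) (f : Cell n m → ℕ) : Set where
  field
    inRange  : ∀ c → 1 ≤ f c × f c ≤ numCells n m
    usedOnce : ∀ v → 1 ≤ v → v ≤ numCells n m → ∃! _≡_ (λ c → f c ≡ v)

record IsSelberg (n m : ℕ) (f : Cell n m → ℕ) : Set where
  field
    isFilling : IsFilling n m f
    between   : ∀ (p : Fin m) (i j : Fin n) (i<j : i Fin.< j) →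
                f (diag i) < f (off p i j i<j) × f (off p i j i<j) < f (diag j)

-- Rows and columns include the diagonal cells.
record IsYoung (n m : ℕ) (f : Cell n m → ℕ) : Set where
  field
    isSelberg : IsSelberg n m f
    rows      : ∀ (p : Fin m) (i j k : Fin n) (i≤j : i Fin.≤ j) (i≤k : i Fin.≤ k) →
                j Fin.< k → f (page p i j i≤j) < f (page p i k i≤k)
    columns   : ∀ (p : Fin m) (i k j : Fin n) (i≤j : i Fin.≤ j) (k≤j : k Fin.≤ j) →
                i Fin.< k → f (page p i j i≤j) < f (page p k j k≤j)

-- Position i in d₁,…,dₙ₋₁ compares the diagonal cells at `lower i` and `upper i`.
lower upper : ∀ {n} → Fin (pred n) → Fin n
lower {suc n} i = inject₁ i
upper {suc n} i = Fin.suc i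

-- dᵢ = eᵢ₊₁ - eᵢ - 1, rearranged to avoid truncated subtraction.
HasGaps : (n m : ℕ) → (Fin (pred n) → ℕ) → (Cell n m → ℕ) → Set
HasGaps n m d f = ∀ i → f (diag (upper i)) ≡ f (diag (lower i)) + d i + 1

-- Books are equal when they have the same entries; the proofs of the
-- defining conditions are ignored.
Books : (n m : ℕ) → ((Cell n m → ℕ) → Set) → Setoid 0ℓ 0ℓ
Books n m P = On.setoid {B = Σ (Cell n m → ℕ) P} (Cell n m →-setoid ℕ) proj₁

SB YB : (n m : ℕ) → Setoid 0ℓ 0ℓ
SB n m = Books n m (IsSelberg n m)
YB n m = Books n m (IsYoung n m)

SBGaps YBGaps : (n m : ℕ) → (Fin (pred n) → ℕ) → Setoid 0ℓ 0ℓ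
SBGaps n m d = Books n m (λ f → IsSelberg n m f × HasGaps n m d f)
YBGaps n m d = Books n m (λ f → IsYoung n m f × HasGaps n m d f)

HasCard : Setoid 0ℓ 0ℓ → ℕ → Set
HasCard S k = Inverse (setoid (Fin k)) S

-- 1! · 2! ⋯ (n-1)!
superfactorial : ℕ → ℕ
superfactorial n = product (applyUpTo (λ i → suc i !) (pred n))

{-# OPTIONS --safe #-}
module Submission where

-- Work in ℤ[τ₁, …, τ_N] / (τ₁², …, τ_N²) with N the number of cells.  The coefficient of
-- τ₁ ⋯ τ_N in the product of the τ_{f c} over all cells c is 1 if f is a filling and 0
-- otherwise, so both kinds of books are counted by the top coefficient of a sum over diagonals
-- e₁ ≤ … ≤ eₙ of the diagonal's monomial times the m-th power of a generating function of pages.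
-- With X v = ∑_{u < v} τᵤ, Selberg pages give the Vandermonde product ∏_{i<j} (X eⱼ - X eᵢ).
-- Young pages are peeled diagonal by diagonal: the entries next to the diagonal interlace it
-- and are themselves the diagonal of a smaller page.  Since τᵥ² = 0, the sum of
-- (k + 1) τᵥ (X v)ᵏ over a ≤ v < b telescopes exactly to (X b)ᵏ⁺¹ - (X a)ᵏ⁺¹, so integrating the
-- Vandermonde determinant of size n - 1 over the interlacing region gives that of size n divided
-- by (n - 1)!.  By induction Young pages give the Vandermonde product over 1! 2! ⋯ (n - 1)!.

open import Defs
open import Level using (0ℓ)
open import Algebra.Bundles using (CommutativeRing)
open import Algebra.Core using (Op₁; Op₂)
open import Algebra.Solver.Ring.AlmostCommutativeRing using (AlmostCommutativeRing; fromCommutativeRing; _-Raw-AlmostCommutative⟶_)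
open import Algebra.Structures using (IsCommutativeRing)
import Algebra.Solver.Ring as RingSolver
open import Data.Empty using (⊥-elim)
open import Data.Fin as Fin using (Fin; zero; suc; inject₁; toℕ)
import Data.Fin.Properties as Finₚ
open import Data.Integer as ℤ using (ℤ) renaming (+_ to pos)
import Data.Integer.Properties as ℤₚ
open import Data.List as List using (List; []; _∷_; _++_; length; filter; applyUpTo; cartesianProductWith; cartesianProduct; concatMap; allFin; tabulate)
open import Data.List.Membership.Propositional using (_∈_; find; lose)
open import Data.List.Membership.Propositional.Properties
import Data.List.Properties as Listₚ
open import Data.List.Relation.Unary.All as ListAll using ([]; _∷_)
open import Data.List.Relation.Unary.AllPairs using ([]; _∷_)
open import Data.List.Relation.Unary.Any as Any using (here; there)
open import Data.List.Relation.Unary.Any.Properties using (lookup-index)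
open import Data.List.Relation.Unary.Unique.Propositional using (Unique)
import Data.List.Relation.Unary.Unique.Propositional.Properties as Uniqueₚ
open import Data.Maybe using (Maybe; just; nothing)
open import Data.Nat as ℕ using (ℕ; zero; suc; _∸_; _≤_; _<_; _!; s≤s; z≤n; NonZero)
open import Data.Nat.ListAction using (product)
open import Data.Nat.ListAction.Properties using (product-++)
import Data.Nat.Properties as ℕₚ
open import Data.Product using (_×_; _,_; proj₁; proj₂; Σ; ∃; ∃₂)
open import Data.Sum using (_⊎_; inj₁; inj₂; [_,_]′)
open import Data.Sum.Properties using (inj₁-injective; inj₂-injective)
open import Data.Unit using (⊤; tt)
open import Data.Vec as Vec using (Vec; []; _∷_; map; toList; lookup)
import Data.Vec.Properties as Vecₚ
open import Data.Vec.Relation.Unary.All as All using (All; []; _∷_)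
import Data.Vec.Relation.Unary.All.Properties as Allₚ
open import Data.Vec.Relation.Unary.AllPairs using (AllPairs; []; _∷_; allPairs?)
open import Function using (_∘_; id; case_of_)
open import Relation.Binary.PropositionalEquality
open import Relation.Nullary using (Dec; yes; no)
open import Relation.Nullary.Decidable using (_×-dec_)

-- Commutative ℤ-algebras and exterior powers

-- Distinctness of the entries ties all pages together and blocks a count page by page. Square-zero
-- variables absorb it: a repeated value makes the monomial vanish, so for a fixed diagonal the
-- pages can be chosen independently, and the comparison reduces to a single page. The same
-- vanishing admits looser candidates, whose entries may equal their lower bounds; their ranges
-- `[a, b)` abut, which is what telescoping asks for. Since the two sums are compared for each
-- diagonal separately, a gap condition merely restricts the outer sum.
--
-- The exterior algebra supplies determinants into which a sum can be pushed row by row: each entry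
-- of an interlacing line occurs in one row only and ranges independently of the others. Nothing is
-- ever divided: integrating column j costs the factor j + 1, these factors multiply to a factorial,
-- and they stay on the Young side as a multiplier. The differences force coefficients in ℤ; the
-- count returns to ℕ because `pos` is injective.

record ℤ-Algebra : Set₁ where
  infixl 6 _+_ _-_
  infixl 7 _*_
  infix  8 -_
  field
    Carrier : Set
    _+_ _*_ : Op₂ Carrier
    -_      : Op₁ Carrier
    -- The structure map. Zero and one are its values by definition, so a ring solver with integer
    -- coefficients serves every algebra below; it also carries the factorials into the algebra.
    ι       : ℤ → Carrier
    isCommutativeRing : IsCommutativeRing _≡_ _+_ _*_ -_ (ι (pos 0)) (ι (pos 1))
    ι-+     : ∀ a b → ι (a ℤ.+ b) ≡ ι a + ι b
    ι-*     : ∀ a b → ι (a ℤ.* b) ≡ ι a * ι b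
    ι-neg   : ∀ a → ι (ℤ.- a) ≡ - ι a

  0# 1# : Carrier
  0# = ι (pos 0)
  1# = ι (pos 1)

  _-_ : Op₂ Carrier
  x - y = x + - y

  commutativeRing : CommutativeRing 0ℓ 0ℓ
  commutativeRing = record { isCommutativeRing = isCommutativeRing }

module Solver (A : ℤ-Algebra) where
  open ℤ-Algebra A

  almostCommutativeRing : AlmostCommutativeRing 0ℓ 0ℓ
  almostCommutativeRing = fromCommutativeRing commutativeRing

  coefficients : ℤ.+-*-rawRing -Raw-AlmostCommutative⟶ almostCommutativeRing
  coefficients = record
    { ⟦_⟧ = ι ; +-homo = ι-+ ; *-homo = ι-* ; -‿homo = ι-neg ; 0-homo = refl ; 1-homo = refl }

  ι-≟ : ∀ a b → Maybe (ι a ≡ ι b)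
  ι-≟ a b with a ℤ.≟ b
  ... | yes a≡b = just (cong ι a≡b)
  ... | no _    = nothing

  open RingSolver ℤ.+-*-rawRing almostCommutativeRing coefficients ι-≟ public

module Exterior (A : ℤ-Algebra) where
  open ℤ-Algebra A
  open Solver A using (solve; con; _:+_; _:*_; _:-_; :-_; _:=_)
  open ≡-Reasoning

  infixl 6 _⊕_ _⊖_
  infixr 7 _·_
  infix  5 _∧+_

  -- The exterior algebra of a free module with basis e₀, e₁, …, e_{k-1}:
  -- a ∧+ b stands for a + e₀ ∧ b, where a and b involve only e₁, …, e_{k-1}.
  data Λ : ℕ → Set where
    scalar : Carrier → Λ 0
    _∧+_   : ∀ {k} → Λ k → Λ k → Λ (suc k)

  _⊕_ _⊖_ : ∀ {k} → Λ k → Λ k → Λ k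
  scalar x ⊕ scalar y = scalar (x + y)
  (a ∧+ b) ⊕ (c ∧+ d) = (a ⊕ c) ∧+ (b ⊕ d)
  scalar x ⊖ scalar y = scalar (x - y)
  (a ∧+ b) ⊖ (c ∧+ d) = (a ⊖ c) ∧+ (b ⊖ d)

  _·_ : ∀ {k} → Carrier → Λ k → Λ k
  c · scalar x = scalar (c * x)
  c · (a ∧+ b) = (c · a) ∧+ (c · b)

  𝟘 𝟙 : ∀ {k} → Λ k
  𝟘 {zero}  = scalar 0#
  𝟘 {suc k} = 𝟘 ∧+ 𝟘
  𝟙 {zero}  = scalar 1#
  𝟙 {suc k} = 𝟙 ∧+ 𝟘

  -- The coefficient of e₀ ∧ ... ∧ e_{k-1}. On a wedge of k vectors it is the determinant of the
  -- matrix with these rows.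
  volume : ∀ {k} → Λ k → Carrier
  volume (scalar x) = x
  volume (a ∧+ b)   = volume b

  -- Left multiplication by the vector ∑ⱼ v j eⱼ.
  wedge : ∀ {k} → (ℕ → Carrier) → Λ k → Λ k
  wedge v (scalar x) = 𝟘
  wedge v (a ∧+ b)   = wedge (v ∘ suc) a ∧+ (v 0 · a ⊖ wedge (v ∘ suc) b)

  ·-⊕ : ∀ {k} c (x y : Λ k) → c · (x ⊕ y) ≡ c · x ⊕ c · y
  ·-⊕ c (scalar x) (scalar y) = cong scalar (solve 3 (λ c x y → c :* (x :+ y) := c :* x :+ c :* y) refl c x y)
  ·-⊕ c (a ∧+ b)   (a′ ∧+ b′) = cong₂ _∧+_ (·-⊕ c a a′) (·-⊕ c b b′)

  ·-⊖ : ∀ {k} c (x y : Λ k) → c · (x ⊖ y) ≡ c · x ⊖ c · y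
  ·-⊖ c (scalar x) (scalar y) = cong scalar (solve 3 (λ c x y → c :* (x :- y) := c :* x :- c :* y) refl c x y)
  ·-⊖ c (a ∧+ b)   (a′ ∧+ b′) = cong₂ _∧+_ (·-⊖ c a a′) (·-⊖ c b b′)

  +-· : ∀ {k} c d (x : Λ k) → (c + d) · x ≡ c · x ⊕ d · x
  +-· c d (scalar x) = cong scalar (solve 3 (λ c d x → (c :+ d) :* x := c :* x :+ d :* x) refl c d x)
  +-· c d (a ∧+ b)   = cong₂ _∧+_ (+-· c d a) (+-· c d b)

  *-· : ∀ {k} c d (x : Λ k) → (c * d) · x ≡ c · d · x
  *-· c d (scalar x) = cong scalar (solve 3 (λ c d x → (c :* d) :* x := c :* (d :* x)) refl c d x)
  *-· c d (a ∧+ b)   = cong₂ _∧+_ (*-· c d a) (*-· c d b)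

  ·-swap : ∀ {k} c d (x : Λ k) → c · d · x ≡ d · c · x
  ·-swap c d (scalar x) = cong scalar (solve 3 (λ c d x → c :* (d :* x) := d :* (c :* x)) refl c d x)
  ·-swap c d (a ∧+ b)   = cong₂ _∧+_ (·-swap c d a) (·-swap c d b)

  1-· : ∀ {k} (x : Λ k) → 1# · x ≡ x
  1-· (scalar x) = cong scalar (solve 1 (λ x → con (pos 1) :* x := x) refl x)
  1-· (a ∧+ b)   = cong₂ _∧+_ (1-· a) (1-· b)

  0-· : ∀ {k} (x : Λ k) → 0# · x ≡ 𝟘
  0-· (scalar x) = cong scalar (solve 1 (λ x → con (pos 0) :* x := con (pos 0)) refl x)
  0-· (a ∧+ b)   = cong₂ _∧+_ (0-· a) (0-· b)

  ·-𝟘 : ∀ {k} c → c · 𝟘 {k} ≡ 𝟘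
  ·-𝟘 {zero}  c = cong scalar (solve 1 (λ c → c :* con (pos 0) := con (pos 0)) refl c)
  ·-𝟘 {suc k} c = cong₂ _∧+_ (·-𝟘 c) (·-𝟘 c)

  ⊖-𝟘 : ∀ {k} (x : Λ k) → x ⊖ 𝟘 ≡ x
  ⊖-𝟘 (scalar x) = cong scalar (solve 1 (λ x → x :- con (pos 0) := x) refl x)
  ⊖-𝟘 (a ∧+ b)   = cong₂ _∧+_ (⊖-𝟘 a) (⊖-𝟘 b)

  ⊖-self : ∀ {k} (x : Λ k) → x ⊖ x ≡ 𝟘
  ⊖-self (scalar x) = cong scalar (solve 1 (λ x → x :- x := con (pos 0)) refl x)
  ⊖-self (a ∧+ b)   = cong₂ _∧+_ (⊖-self a) (⊖-self b)

  ⊖-⊖-⊖ : ∀ {k} (x y z t : Λ k) → (x ⊖ y) ⊖ (z ⊖ t) ≡ (x ⊖ z) ⊖ (y ⊖ t)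
  ⊖-⊖-⊖ (scalar x) (scalar y) (scalar z) (scalar t) =
    cong scalar (solve 4 (λ x y z t → (x :- y) :- (z :- t) := (x :- z) :- (y :- t)) refl x y z t)
  ⊖-⊖-⊖ (a ∧+ b) (c ∧+ d) (e ∧+ f) (g ∧+ h) = cong₂ _∧+_ (⊖-⊖-⊖ a c e g) (⊖-⊖-⊖ b d f h)

  ⊕-⊖-⊕ : ∀ {k} (x y z t : Λ k) → (x ⊕ y) ⊖ (z ⊕ t) ≡ (x ⊖ z) ⊕ (y ⊖ t)
  ⊕-⊖-⊕ (scalar x) (scalar y) (scalar z) (scalar t) =
    cong scalar (solve 4 (λ x y z t → (x :+ y) :- (z :+ t) := (x :- z) :+ (y :- t)) refl x y z t)
  ⊕-⊖-⊕ (a ∧+ b) (c ∧+ d) (e ∧+ f) (g ∧+ h) = cong₂ _∧+_ (⊕-⊖-⊕ a c e g) (⊕-⊖-⊕ b d f h)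

  minus-· : ∀ {k} c d (x : Λ k) → (c - d) · x ≡ c · x ⊖ d · x
  minus-· c d (scalar x) = cong scalar (solve 3 (λ c d x → (c :- d) :* x := c :* x :- d :* x) refl c d x)
  minus-· c d (a ∧+ b)   = cong₂ _∧+_ (minus-· c d a) (minus-· c d b)

  wedge-cong : ∀ {k} {u v} → u ≗ v → (x : Λ k) → wedge u x ≡ wedge v x
  wedge-cong u≗v (scalar x) = refl
  wedge-cong u≗v (a ∧+ b)   =
    cong₂ _∧+_ (wedge-cong (u≗v ∘ suc) a)
               (cong₂ _⊖_ (cong (_· a) (u≗v 0)) (wedge-cong (u≗v ∘ suc) b))

  wedge-⊖ : ∀ {k} v (x y : Λ k) → wedge v (x ⊖ y) ≡ wedge v x ⊖ wedge v y
  wedge-⊖ v (scalar x) (scalar y) = sym (⊖-self 𝟘)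
  wedge-⊖ v (a ∧+ b)   (c ∧+ d)   = cong₂ _∧+_ (wedge-⊖ _ a c)
    (trans (cong₂ _⊖_ (·-⊖ _ a c) (wedge-⊖ _ b d)) (⊖-⊖-⊖ (v 0 · a) _ _ _))

  wedge-· : ∀ {k} v c (x : Λ k) → wedge v (c · x) ≡ c · wedge v x
  wedge-· v c (scalar x) = sym (·-𝟘 {0} c)
  wedge-· v c (a ∧+ b)   = cong₂ _∧+_ (wedge-· _ c a)
    (trans (cong₂ _⊖_ (·-swap (v 0) c a) (wedge-· _ c b)) (sym (·-⊖ c (v 0 · a) _)))

  wedge-𝟘 : ∀ {k} v → wedge v (𝟘 {k}) ≡ 𝟘
  wedge-𝟘 {k} v = trans (cong (wedge v) (sym (0-· 𝟘))) (trans (wedge-· v 0# 𝟘) (0-· (wedge v (𝟘 {k}))))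

  ⊕-𝟘 : ∀ {k} (x : Λ k) → x ⊕ 𝟘 ≡ x
  ⊕-𝟘 (scalar x) = cong scalar (solve 1 (λ x → x :+ con (pos 0) := x) refl x)
  ⊕-𝟘 (a ∧+ b)   = cong₂ _∧+_ (⊕-𝟘 a) (⊕-𝟘 b)

  wedge-⊕ : ∀ {k} v (x y : Λ k) → wedge v (x ⊕ y) ≡ wedge v x ⊕ wedge v y
  wedge-⊕ v (scalar x) (scalar y) = sym (⊕-𝟘 𝟘)
  wedge-⊕ v (a ∧+ b)   (c ∧+ d)   = cong₂ _∧+_ (wedge-⊕ _ a c)
    (trans (cong₂ _⊖_ (·-⊕ _ a c) (wedge-⊕ _ b d)) (⊕-⊖-⊕ (v 0 · a) _ _ _))

  +-wedge : ∀ {k} u v (x : Λ k) → wedge (λ j → u j + v j) x ≡ wedge u x ⊕ wedge v x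
  +-wedge u v (scalar x) = sym (⊕-𝟘 𝟘)
  +-wedge u v (a ∧+ b)   = cong₂ _∧+_ (+-wedge _ _ a)
    (trans (cong₂ _⊖_ (+-· (u 0) (v 0) a) (+-wedge _ _ b)) (⊕-⊖-⊕ (u 0 · a) _ _ _))

  minus-wedge : ∀ {k} u v (x : Λ k) → wedge (λ j → u j - v j) x ≡ wedge u x ⊖ wedge v x
  minus-wedge u v (scalar x) = sym (⊖-self 𝟘)
  minus-wedge u v (a ∧+ b)   = cong₂ _∧+_ (minus-wedge _ _ a)
    (trans (cong₂ _⊖_ (minus-· (u 0) (v 0) a) (minus-wedge _ _ b)) (⊖-⊖-⊖ (u 0 · a) _ _ _))

  *-wedge : ∀ {k} c v (x : Λ k) → wedge (λ j → c * v j) x ≡ c · wedge v x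
  *-wedge c v (scalar x) = sym (·-𝟘 {0} c)
  *-wedge c v (a ∧+ b)   = cong₂ _∧+_ (*-wedge c _ a)
    (trans (cong₂ _⊖_ (*-· c (v 0) a) (*-wedge c _ b)) (sym (·-⊖ c (v 0 · a) _)))

  -- The two cross terms `v 0 · wedge v′ a` cancel. A separate recursion is used because
  -- `wedge-anticomm` with equal vectors only shows that twice the wedge is zero.
  wedge-self : ∀ {k} v (x : Λ k) → wedge v (wedge v x) ≡ 𝟘
  wedge-self v (scalar x) = refl
  wedge-self v (a ∧+ b)   = cong₂ _∧+_ (wedge-self _ a) (begin
    v 0 · wedge v′ a ⊖ wedge v′ (v 0 · a ⊖ wedge v′ b)              ≡⟨ cong (v 0 · wedge v′ a ⊖_) (wedge-⊖ v′ (v 0 · a) (wedge v′ b)) ⟩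
    v 0 · wedge v′ a ⊖ (wedge v′ (v 0 · a) ⊖ wedge v′ (wedge v′ b)) ≡⟨ cong (v 0 · wedge v′ a ⊖_) (cong₂ _⊖_ (wedge-· v′ (v 0) a) (wedge-self v′ b)) ⟩
    v 0 · wedge v′ a ⊖ (v 0 · wedge v′ a ⊖ 𝟘)                       ≡⟨ cong (v 0 · wedge v′ a ⊖_) (⊖-𝟘 _) ⟩
    v 0 · wedge v′ a ⊖ v 0 · wedge v′ a                             ≡⟨ ⊖-self _ ⟩
    𝟘                                                               ∎)
    where v′ = v ∘ suc

  wedge-anticomm : ∀ {k} u v (x : Λ k) → wedge u (wedge v x) ≡ 𝟘 ⊖ wedge v (wedge u x)
  wedge-anticomm u v (scalar x) = sym (⊖-self 𝟘)
  wedge-anticomm u v (a ∧+ b)   = cong₂ _∧+_ (wedge-anticomm _ _ a) (begin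
    u 0 · wedge v′ a ⊖ wedge u′ (v 0 · a ⊖ wedge v′ b)
      ≡⟨ cong (u 0 · wedge v′ a ⊖_) (trans (wedge-⊖ u′ (v 0 · a) (wedge v′ b)) (cong₂ _⊖_ (wedge-· u′ (v 0) a) (wedge-anticomm u′ v′ b))) ⟩
    u 0 · wedge v′ a ⊖ (v 0 · wedge u′ a ⊖ (𝟘 ⊖ wedge v′ (wedge u′ b)))
      ≡⟨ regroup (u 0 · wedge v′ a) _ _ ⟩
    𝟘 ⊖ (v 0 · wedge u′ a ⊖ (u 0 · wedge v′ a ⊖ wedge v′ (wedge u′ b)))
      ≡⟨ cong (λ t → 𝟘 ⊖ (v 0 · wedge u′ a ⊖ t)) (trans (wedge-⊖ v′ (u 0 · a) (wedge u′ b)) (cong (_⊖ wedge v′ (wedge u′ b)) (wedge-· v′ (u 0) a))) ⟨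
    𝟘 ⊖ (v 0 · wedge u′ a ⊖ wedge v′ (u 0 · a ⊖ wedge u′ b)) ∎)
    where
    u′ = u ∘ suc
    v′ = v ∘ suc
    regroup : ∀ {k} (x y z : Λ k) → x ⊖ (y ⊖ (𝟘 ⊖ z)) ≡ 𝟘 ⊖ (y ⊖ (x ⊖ z))
    regroup (scalar x) (scalar y) (scalar z) = cong scalar
      (solve 3 (λ x y z → x :- (y :- (con (pos 0) :- z)) := con (pos 0) :- (y :- (x :- z))) refl x y z)
    regroup (a ∧+ b) (c ∧+ d) (e ∧+ f) = cong₂ _∧+_ (regroup a c e) (regroup b d f)

  volume-⊕ : ∀ {k} (x y : Λ k) → volume (x ⊕ y) ≡ volume x + volume y
  volume-⊕ (scalar x) (scalar y) = refl
  volume-⊕ (a ∧+ b)   (c ∧+ d)   = volume-⊕ b d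

  volume-· : ∀ {k} c (x : Λ k) → volume (c · x) ≡ c * volume x
  volume-· c (scalar x) = refl
  volume-· c (a ∧+ b)   = volume-· c b

  -- Diagonal scalings and shears of the exterior algebra

  scale : (c v : ℕ → Carrier) → ℕ → Carrier
  scale c v j = c j * v j

  -- The algebra endomorphism extending eⱼ ↦ cⱼ eⱼ. It rescales the columns of a determinant, and so
  -- collects the factors that clear the denominators of an integration.
  scaleΛ : ∀ {k} → (ℕ → Carrier) → Λ k → Λ k
  scaleΛ c (scalar x) = scalar x
  scaleΛ c (a ∧+ b)   = scaleΛ (c ∘ suc) a ∧+ c 0 · scaleΛ (c ∘ suc) b

  scaleΛ-⊖ : ∀ {k} c (x y : Λ k) → scaleΛ c (x ⊖ y) ≡ scaleΛ c x ⊖ scaleΛ c y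
  scaleΛ-⊖ c (scalar x) (scalar y) = refl
  scaleΛ-⊖ c (a ∧+ b)   (d ∧+ e)   = cong₂ _∧+_ (scaleΛ-⊖ _ a d)
    (trans (cong (c 0 ·_) (scaleΛ-⊖ _ b e)) (·-⊖ (c 0) (scaleΛ _ b) _))

  scaleΛ-· : ∀ {k} c d (x : Λ k) → scaleΛ c (d · x) ≡ d · scaleΛ c x
  scaleΛ-· c d (scalar x) = refl
  scaleΛ-· c d (a ∧+ b)   = cong₂ _∧+_ (scaleΛ-· _ d a)
    (trans (cong (c 0 ·_) (scaleΛ-· _ d b)) (·-swap (c 0) d _))

  scaleΛ-𝟘 : ∀ {k} c → scaleΛ c (𝟘 {k}) ≡ 𝟘
  scaleΛ-𝟘 {zero}  c = refl
  scaleΛ-𝟘 {suc k} c = cong₂ _∧+_ (scaleΛ-𝟘 _) (trans (cong (c 0 ·_) (scaleΛ-𝟘 _)) (·-𝟘 (c 0)))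

  scaleΛ-𝟙 : ∀ {k} c → scaleΛ c (𝟙 {k}) ≡ 𝟙
  scaleΛ-𝟙 {zero}  c = refl
  scaleΛ-𝟙 {suc k} c = cong₂ _∧+_ (scaleΛ-𝟙 _) (trans (cong (c 0 ·_) (scaleΛ-𝟘 _)) (·-𝟘 (c 0)))

  scaleΛ-wedge : ∀ {k} c v (x : Λ k) → scaleΛ c (wedge v x) ≡ wedge (scale c v) (scaleΛ c x)
  scaleΛ-wedge c v (scalar x) = refl
  scaleΛ-wedge c v (a ∧+ b)   = cong₂ _∧+_ (scaleΛ-wedge c′ v′ a) (begin
    c 0 · scaleΛ c′ (v 0 · a ⊖ wedge v′ b)
      ≡⟨ cong (c 0 ·_) (scaleΛ-⊖ c′ (v 0 · a) (wedge v′ b)) ⟩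
    c 0 · (scaleΛ c′ (v 0 · a) ⊖ scaleΛ c′ (wedge v′ b))
      ≡⟨ cong (c 0 ·_) (cong₂ _⊖_ (scaleΛ-· c′ (v 0) a) (scaleΛ-wedge c′ v′ b)) ⟩
    c 0 · (v 0 · scaleΛ c′ a ⊖ wedge (scale c′ v′) (scaleΛ c′ b))
      ≡⟨ ·-⊖ (c 0) (v 0 · scaleΛ c′ a) _ ⟩
    c 0 · v 0 · scaleΛ c′ a ⊖ c 0 · wedge (scale c′ v′) (scaleΛ c′ b)
      ≡⟨ cong₂ _⊖_ (*-· (c 0) (v 0) _) (wedge-· (scale c′ v′) (c 0) (scaleΛ c′ b)) ⟨
    (c 0 * v 0) · scaleΛ c′ a ⊖ wedge (scale c′ v′) (c 0 · scaleΛ c′ b) ∎)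
    where
    c′ = c ∘ suc
    v′ = v ∘ suc

  ∏< : ℕ → (ℕ → Carrier) → Carrier
  ∏< zero    c = 1#
  ∏< (suc k) c = c 0 * ∏< k (c ∘ suc)

  volume-scaleΛ : ∀ {k} c (x : Λ k) → volume (scaleΛ c x) ≡ ∏< k c * volume x
  volume-scaleΛ c (scalar x)         = solve 1 (λ x → x := con (pos 1) :* x) refl x
  volume-scaleΛ {suc k} c (a ∧+ b) = begin
    volume (c 0 · scaleΛ (c ∘ suc) b)       ≡⟨ volume-· (c 0) (scaleΛ (c ∘ suc) b) ⟩
    c 0 * volume (scaleΛ (c ∘ suc) b)       ≡⟨ cong (c 0 *_) (volume-scaleΛ (c ∘ suc) b) ⟩
    c 0 * (∏< k (c ∘ suc) * volume b)       ≡⟨ solve 3 (λ x y z → x :* (y :* z) := (x :* y) :* z) refl (c 0) _ _ ⟩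
    c 0 * ∏< k (c ∘ suc) * volume b         ∎

  -- The first basis vector. Used on the components of `a ∧+ b`, which live on e₁, e₂, ..., it
  -- stands for e₁.
  unit : ℕ → Carrier
  unit zero    = 1#
  unit (suc _) = 0#

  -- The coordinates of the image of ∑ⱼ v j eⱼ under eⱼ ↦ eⱼ - c eⱼ₊₁; on a matrix, the column
  -- operations that clear a Vandermonde row.
  shear : Carrier → (ℕ → Carrier) → ℕ → Carrier
  shear c v zero    = v 0
  shear c v (suc j) = v (suc j) - c * v j

  -- The automorphism extending eⱼ ↦ eⱼ - c eⱼ₊₁.
  shearΛ : ∀ {k} → Carrier → Λ k → Λ k
  shearΛ c (scalar x) = scalar x
  shearΛ c (a ∧+ b)   = (shearΛ c a ⊖ c · wedge unit (shearΛ c b)) ∧+ shearΛ c b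

  -- The substitution is unitriangular. In this encoding its correction term only enters the first
  -- component, which `volume` never reads.
  volume-shearΛ : ∀ {k} c (x : Λ k) → volume (shearΛ c x) ≡ volume x
  volume-shearΛ c (scalar x) = refl
  volume-shearΛ c (a ∧+ b)   = volume-shearΛ c b

  shearΛ-⊖ : ∀ {k} c (x y : Λ k) → shearΛ c (x ⊖ y) ≡ shearΛ c x ⊖ shearΛ c y
  shearΛ-⊖ c (scalar x) (scalar y) = refl
  shearΛ-⊖ c (a ∧+ b)   (d ∧+ e)   = cong₂ _∧+_
    (trans (cong₂ _⊖_ (shearΛ-⊖ c a d)
             (trans (cong (c ·_) (trans (cong (wedge unit) (shearΛ-⊖ c b e)) (wedge-⊖ unit (shearΛ c b) (shearΛ c e))))
                    (·-⊖ c (wedge unit (shearΛ c b)) _)))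
           (⊖-⊖-⊖ (shearΛ c a) _ _ _))
    (shearΛ-⊖ c b e)

  shearΛ-· : ∀ {k} c d (x : Λ k) → shearΛ c (d · x) ≡ d · shearΛ c x
  shearΛ-· c d (scalar x) = refl
  shearΛ-· c d (a ∧+ b)   = cong₂ _∧+_
    (trans (cong₂ _⊖_ (shearΛ-· c d a)
             (trans (cong (c ·_) (trans (cong (wedge unit) (shearΛ-· c d b)) (wedge-· unit d (shearΛ c b))))
                    (·-swap c d _)))
           (sym (·-⊖ d (shearΛ c a) _)))
    (shearΛ-· c d b)

  shearΛ-𝟘 : ∀ {k} c → shearΛ c (𝟘 {k}) ≡ 𝟘
  shearΛ-𝟘 {k} c = trans (cong (shearΛ c) (sym (0-· 𝟘))) (trans (shearΛ-· c 0# 𝟘) (0-· (shearΛ c (𝟘 {k}))))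

  shearΛ-𝟙 : ∀ {k} c → shearΛ c (𝟙 {k}) ≡ 𝟙
  shearΛ-𝟙 {zero}  c = refl
  shearΛ-𝟙 {suc k} c = cong₂ _∧+_
    (trans (cong₂ (λ s t → s ⊖ c · wedge unit t) (shearΛ-𝟙 c) (shearΛ-𝟘 c))
           (trans (cong (λ t → 𝟙 ⊖ c · t) (wedge-𝟘 unit)) (trans (cong (𝟙 ⊖_) (·-𝟘 c)) (⊖-𝟘 𝟙))))
    (shearΛ-𝟘 c)

  -- Shearing and dropping the first coordinate fail to commute in one place only: `v 0` still
  -- contributes to the coordinate that becomes the first.
  shear-∘suc : ∀ c v → shear c v ∘ suc ≗ λ j → shear c (v ∘ suc) j - (c * v 0) * unit j
  shear-∘suc c v zero    = solve 3 (λ c x y → y :- c :* x := y :- (c :* x) :* con (pos 1)) refl c (v 0) (v 1)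
  shear-∘suc c v (suc j) = solve 4 (λ c x y z → z :- c :* y := (z :- c :* y) :- (c :* x) :* con (pos 0)) refl c (v 0) (v (suc j)) (v (suc (suc j)))

  wedge-shear : ∀ {k} c v (x : Λ k) →
    wedge (shear c v ∘ suc) x ≡ wedge (shear c (v ∘ suc)) x ⊖ (c * v 0) · wedge unit x
  wedge-shear c v x = begin
    wedge (shear c v ∘ suc) x                                       ≡⟨ wedge-cong (shear-∘suc c v) x ⟩
    wedge (λ j → shear c (v ∘ suc) j - (c * v 0) * unit j) x        ≡⟨ minus-wedge (shear c (v ∘ suc)) _ x ⟩
    wedge (shear c (v ∘ suc)) x ⊖ wedge (λ j → c * v 0 * unit j) x  ≡⟨ cong (wedge (shear c (v ∘ suc)) x ⊖_) (*-wedge (c * v 0) unit x) ⟩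
    wedge (shear c (v ∘ suc)) x ⊖ (c * v 0) · wedge unit x          ∎

  -- Multiplicativity of the shear. Since e₀ goes to e₀ - c e₁, the two sides differ by terms that
  -- disappear because e₁ anticommutes with the tail of v and e₁ ∧ e₁ = 0.
  shearΛ-wedge : ∀ {k} c v (x : Λ k) → shearΛ c (wedge v x) ≡ wedge (shear c v) (shearΛ c x)
  shearΛ-wedge c v (scalar x) = refl
  shearΛ-wedge c v (a ∧+ b)   = cong₂ _∧+_
    (begin
      shearΛ c (wedge v′ a) ⊖ c · wedge unit (shearΛ c (v 0 · a ⊖ wedge v′ b))
        ≡⟨ cong₂ (λ s t → s ⊖ c · wedge unit t) (shearΛ-wedge c v′ a) second ⟩
      u a′ ⊖ c · wedge unit (v 0 · a′ ⊖ u b′)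
        ≡⟨ cong (λ t → u a′ ⊖ c · t) (trans (wedge-⊖ unit (v 0 · a′) (u b′)) (cong (_⊖ wedge unit (u b′)) (wedge-· unit (v 0) a′))) ⟩
      u a′ ⊖ c · (v 0 · wedge unit a′ ⊖ wedge unit (u b′))
        -- The zeros are inserted in the shape that anticommutation and e₁ ∧ e₁ = 0 produce, so that
        -- the next step can read both laws backwards.
        ≡⟨ first-law (u a′) _ _ c (v 0) ⟩
      (u a′ ⊖ c · (𝟘 ⊖ wedge unit (u b′))) ⊖ (c * v 0) · (wedge unit a′ ⊖ c · 𝟘)
        ≡⟨ cong₂ (λ s t → (u a′ ⊖ c · s) ⊖ (c * v 0) · (wedge unit a′ ⊖ c · t))
             (wedge-anticomm (shear c v′) unit b′) (wedge-self unit b′) ⟨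
      (u a′ ⊖ c · u (wedge unit b′)) ⊖ (c * v 0) · (wedge unit a′ ⊖ c · wedge unit (wedge unit b′))
        ≡⟨ cong₂ (λ s t → s ⊖ (c * v 0) · t) (wedge-⊖· (shear c v′)) (wedge-⊖· unit) ⟨
      u (a′ ⊖ c · wedge unit b′) ⊖ (c * v 0) · wedge unit (a′ ⊖ c · wedge unit b′)
        ≡⟨ wedge-shear c v (a′ ⊖ c · wedge unit b′) ⟨
      wedge (shear c v ∘ suc) (a′ ⊖ c · wedge unit b′) ∎)
    (begin
      shearΛ c (v 0 · a ⊖ wedge v′ b)                                      ≡⟨ second ⟩
      v 0 · a′ ⊖ u b′                                                      ≡⟨ second-law a′ _ _ c (v 0) ⟩
      v 0 · (a′ ⊖ c · wedge unit b′) ⊖ (u b′ ⊖ (c * v 0) · wedge unit b′)  ≡⟨ cong (v 0 · (a′ ⊖ c · wedge unit b′) ⊖_) (wedge-shear c v b′) ⟨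
      v 0 · (a′ ⊖ c · wedge unit b′) ⊖ wedge (shear c v ∘ suc) b′          ∎)
    where
    v′ = v ∘ suc
    a′ = shearΛ c a
    b′ = shearΛ c b
    u  = wedge (shear c v′)

    second : shearΛ c (v 0 · a ⊖ wedge v′ b) ≡ v 0 · a′ ⊖ u b′
    second = trans (shearΛ-⊖ c (v 0 · a) (wedge v′ b)) (cong₂ _⊖_ (shearΛ-· c (v 0) a) (shearΛ-wedge c v′ b))

    wedge-⊖· : ∀ s → wedge s (a′ ⊖ c · wedge unit b′) ≡ wedge s a′ ⊖ c · wedge s (wedge unit b′)
    wedge-⊖· s = trans (wedge-⊖ s a′ (c · wedge unit b′)) (cong (wedge s a′ ⊖_) (wedge-· s c (wedge unit b′)))

    first-law : ∀ {k} (p q r : Λ k) c d → p ⊖ c · (d · q ⊖ r) ≡ (p ⊖ c · (𝟘 ⊖ r)) ⊖ (c * d) · (q ⊖ c · 𝟘)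
    first-law (scalar p) (scalar q) (scalar r) c d = cong scalar
      (solve 5 (λ p q r c d → p :- c :* (d :* q :- r) := (p :- c :* (con (pos 0) :- r)) :- (c :* d) :* (q :- c :* con (pos 0))) refl p q r c d)
    first-law (p ∧+ p′) (q ∧+ q′) (r ∧+ r′) c d = cong₂ _∧+_ (first-law p q r c d) (first-law p′ q′ r′ c d)

    second-law : ∀ {k} (p q r : Λ k) c d → d · p ⊖ q ≡ d · (p ⊖ c · r) ⊖ (q ⊖ (c * d) · r)
    second-law (scalar p) (scalar q) (scalar r) c d = cong scalar
      (solve 5 (λ p q r c d → d :* p :- q := d :* (p :- c :* r) :- (q :- (c :* d) :* r)) refl p q r c d)
    second-law (p ∧+ p′) (q ∧+ q′) (r ∧+ r′) c d = cong₂ _∧+_ (second-law p q r c d) (second-law p′ q′ r′ c d)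

-- Enumerations of triangles and the Vandermonde determinant

range : ℕ → ℕ → List ℕ
range a b = applyUpTo (a ℕ.+_) (b ∸ a)

box : ∀ {n} → ℕ → Vec ℕ n → List (Vec ℕ n)
box a []      = List.[ [] ]
box a (b ∷ e) = cartesianProductWith _∷_ (range a b) (box a e)

interlacing : ∀ {n} → ℕ → Vec ℕ n → List (Vec ℕ n)
interlacing a []      = List.[ [] ]
interlacing a (b ∷ e) = cartesianProductWith _∷_ (range a b) (interlacing b e)

pairs : ∀ {A B : Set} → List A → (A → List B) → List (A × B)
pairs xs ys = concatMap (λ x → List.map (x ,_) (ys x)) xs

vectors : ∀ {A : Set} n → List A → List (Vec A n)
vectors zero    xs = List.[ [] ]
vectors (suc n) xs = cartesianProductWith _∷_ xs (vectors n xs)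

-- The off-diagonal entries of one page, as lines of lengths n - 1, ..., 0. Which cells a line
-- covers is left to a `Layout`: rows of the page for Selberg books, lines parallel to the diagonal
-- for Young books.
Triangle : ℕ → Set
Triangle zero    = ⊤
Triangle (suc n) = Vec ℕ n × Triangle n

entries : ∀ {n} → Triangle n → List ℕ
entries {zero}  tt      = []
entries {suc n} (y , T) = toList y ++ entries T

selbergTriangles : ∀ {n} → Vec ℕ n → List (Triangle n)
selbergTriangles []      = List.[ tt ]
selbergTriangles (a ∷ e) = cartesianProduct (box a e) (selbergTriangles e)

-- Gelfand-Tsetlin patterns with top row `e`, with half-open interlacing: the line just chosen
-- bounds the next one, so the choices depend on each other, unlike in `selbergTriangles`.
youngTriangles : ∀ {n} → Vec ℕ n → List (Triangle n)
youngTriangles []      = List.[ tt ]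
youngTriangles (a ∷ e) = pairs (interlacing a e) youngTriangles

Sorted : ∀ {n} → Vec ℕ n → Set
Sorted = AllPairs _≤_

∈-range⁻ : ∀ {v} a b → v ∈ range a b → a ≤ v × v < b
∈-range⁻ {v} a b v∈ with ∈-applyUpTo⁻ (a ℕ.+_) v∈
... | i , i<b∸a , refl =
  ℕₚ.m≤m+n a i , subst (_≤ b) (cong suc (ℕₚ.+-comm i a)) (ℕₚ.m≤o∸n⇒m+n≤o (suc i) a≤b i<b∸a)
  where
  a≤b : a ≤ b
  a≤b = ℕₚ.<⇒≤ (ℕₚ.m∸n≢0⇒n<m {b} (ℕₚ.>⇒≢ (ℕₚ.≤-<-trans ℕ.z≤n i<b∸a)))

interlacing-≥ : ∀ {n a} {e y : Vec ℕ n} → Sorted (a ∷ e) → y ∈ interlacing a e → All (a ≤_) y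
interlacing-≥ {e = []} {[]} _ _ = []
interlacing-≥ {a = a} {b ∷ e} ((a≤b ∷ _) ∷ sorted) y∈ with ∈-cartesianProductWith⁻ _∷_ (range a b) (interlacing b e) y∈
... | v , y′ , v∈ , y′∈ , refl =
  proj₁ (∈-range⁻ a b v∈) ∷ All.map (ℕₚ.≤-trans a≤b) (interlacing-≥ sorted y′∈)

-- Consecutive entries of `y` are separated by an entry of `e`. This lets the induction in
-- `young-sum` continue with `y` as the diagonal.
interlacing-sorted : ∀ {n a} {e y : Vec ℕ n} → Sorted (a ∷ e) → y ∈ interlacing a e → Sorted y
interlacing-sorted {e = []} {[]} _ _ = []
interlacing-sorted {a = a} {b ∷ e} (_ ∷ sorted) y∈ with ∈-cartesianProductWith⁻ _∷_ (range a b) (interlacing b e) y∈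
... | v , y′ , v∈ , y′∈ , refl =
  All.map (ℕₚ.≤-trans (ℕₚ.<⇒≤ (proj₂ (∈-range⁻ a b v∈)))) (interlacing-≥ sorted y′∈) ∷ interlacing-sorted sorted y′∈

superfactorial-suc : ∀ n → superfactorial (suc n) ≡ n ! ℕ.* superfactorial n
superfactorial-suc zero    = refl
superfactorial-suc (suc n) = begin
  product (applyUpTo f (suc n))                    ≡⟨ cong product (Listₚ.applyUpTo-∷ʳ f n) ⟨
  product (applyUpTo f n ++ List.[ suc n ! ])      ≡⟨ product-++ (applyUpTo f n) _ ⟩
  product (applyUpTo f n) ℕ.* (suc n ! ℕ.* 1)      ≡⟨ cong (product (applyUpTo f n) ℕ.*_) (ℕₚ.*-identityʳ (suc n !)) ⟩
  product (applyUpTo f n) ℕ.* (suc n !)            ≡⟨ ℕₚ.*-comm _ (suc n !) ⟩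
  suc n ! ℕ.* product (applyUpTo f n)              ∎
  where
  open ≡-Reasoning
  f : ℕ → ℕ
  f i = suc i !

module Vandermonde (A : ℤ-Algebra) where
  open ℤ-Algebra A
  open Solver A using (solve; con; _:+_; _:*_; _:-_; :-_; _:=_)
  open Exterior A
  open ≡-Reasoning

  powers : Carrier → ℕ → Carrier
  powers x zero    = 1#
  powers x (suc j) = x * powers x j

  wedges : ∀ {k n} → (Carrier → ℕ → Carrier) → Vec Carrier n → Λ k
  wedges r []       = 𝟙
  wedges r (x ∷ xs) = wedge (r x) (wedges r xs)

  differences : ∀ {n} → Carrier → Vec Carrier n → Carrier
  differences x []       = 1#
  differences x (y ∷ ys) = (y - x) * differences x ys

  vandermonde : ∀ {n} → Vec Carrier n → Carrier
  vandermonde []       = 1#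
  vandermonde (x ∷ xs) = differences x xs * vandermonde xs

  shearΛ-wedges : ∀ {k n} c r (xs : Vec Carrier n) →
    shearΛ c (wedges {k} r xs) ≡ wedges (shear c ∘ r) xs
  shearΛ-wedges c r []       = shearΛ-𝟙 c
  shearΛ-wedges c r (x ∷ xs) =
    trans (shearΛ-wedge c (r x) (wedges r xs)) (cong (wedge (shear c (r x))) (shearΛ-wedges c r xs))

  constantPart : ∀ {k} → Λ (suc k) → Λ k
  constantPart (a ∧+ _) = a

  constantPart-wedges : ∀ {k n} r (xs : Vec Carrier n) →
    constantPart (wedges {suc k} r xs) ≡ wedges (λ x → r x ∘ suc) xs
  constantPart-wedges r []       = refl
  constantPart-wedges {k} r (x ∷ xs) with wedges {suc k} r xs | constantPart-wedges {k} r xs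
  ... | a ∧+ b | refl = refl

  -- Laplace expansion along a row (1, 0, ..., 0).
  wedge-1,0 : ∀ {k} v (x : Λ (suc k)) → v 0 ≡ 1# → (∀ j → v (suc j) ≡ 0#) →
    volume (wedge v x) ≡ volume (constantPart x)
  wedge-1,0 v (a ∧+ b) v₀≡1 v₊≡0 = cong volume (begin
    v 0 · a ⊖ wedge (v ∘ suc) b          ≡⟨ cong₂ _⊖_ (cong (_· a) v₀≡1) (wedge-cong (λ j → trans (v₊≡0 j) 0≡0*0) b) ⟩
    1# · a ⊖ wedge (λ j → 0# * 0#) b     ≡⟨ cong₂ _⊖_ (1-· a) (trans (*-wedge 0# (λ _ → 0#) b) (0-· _)) ⟩
    a ⊖ 𝟘                                ≡⟨ ⊖-𝟘 a ⟩
    a                                    ∎)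
    where
    0≡0*0 : 0# ≡ 0# * 0#
    0≡0*0 = solve 0 (con (pos 0) := con (pos 0) :* con (pos 0)) refl

  -- The sheared row of x has the entries xʲ⁺¹ - c xʲ = (x - c) xʲ, so one scalar leaves each row
  -- and a smaller Vandermonde matrix remains.
  wedges-shear-powers : ∀ {k n} c (xs : Vec Carrier n) →
    wedges {k} (λ x → shear c (powers x) ∘ suc) xs ≡ differences c xs · wedges powers xs
  wedges-shear-powers c []       = sym (1-· 𝟙)
  wedges-shear-powers c (x ∷ xs) = begin
    wedge (λ j → x * powers x j - c * powers x j) (wedges _ xs)
      ≡⟨ cong (wedge _) (wedges-shear-powers c xs) ⟩
    wedge (λ j → x * powers x j - c * powers x j) (differences c xs · wedges powers xs)
      ≡⟨ wedge-cong (λ j → solve 3 (λ x c p → x :* p :- c :* p := (x :- c) :* p) refl x c (powers x j)) (differences c xs · wedges powers xs) ⟩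
    wedge (λ j → (x - c) * powers x j) (differences c xs · wedges powers xs)
      ≡⟨ *-wedge (x - c) (powers x) (differences c xs · wedges powers xs) ⟩
    (x - c) · wedge (powers x) (differences c xs · wedges powers xs)
      ≡⟨ cong ((x - c) ·_) (wedge-· (powers x) (differences c xs) (wedges powers xs)) ⟩
    (x - c) · differences c xs · wedge (powers x) (wedges powers xs)
      ≡⟨ *-· (x - c) (differences c xs) _ ⟨
    ((x - c) * differences c xs) · wedge (powers x) (wedges powers xs) ∎

  -- Subtracting x times each column from the next one turns the row of x into (1, 0, …, 0)
  -- and the row of y into (1, y - x, (y - x) y, …).
  volume-wedges : ∀ {n} (xs : Vec Carrier n) → volume (wedges {n} powers xs) ≡ vandermonde xs
  volume-wedges []                 = refl
  volume-wedges {suc n} (x ∷ xs) = begin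
    volume (wedges powers (x ∷ xs))
      ≡⟨ volume-shearΛ x (wedges powers (x ∷ xs)) ⟨
    volume (shearΛ x (wedges powers (x ∷ xs)))
      ≡⟨ cong volume (shearΛ-wedges x powers (x ∷ xs)) ⟩
    volume (wedge (shear x (powers x)) (wedges (shear x ∘ powers) xs))
      ≡⟨ wedge-1,0 (shear x (powers x)) (wedges (shear x ∘ powers) xs) refl (λ j → solve 1 (λ p → p :- p := con (pos 0)) refl (x * powers x j)) ⟩
    volume (constantPart (wedges (shear x ∘ powers) xs))
      ≡⟨ cong volume (trans (constantPart-wedges (shear x ∘ powers) xs) (wedges-shear-powers x xs)) ⟩
    volume (differences x xs · wedges powers xs)
      ≡⟨ volume-· (differences x xs) (wedges powers xs) ⟩
    differences x xs * volume (wedges {n} powers xs)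
      ≡⟨ cong (differences x xs *_) (volume-wedges xs) ⟩
    differences x xs * vandermonde xs ∎

  -- Differences of consecutive Vandermonde rows without the column of ones. Up to the factor j + 1
  -- in column j these rows are the integrals of the powers between consecutive points.
  steps : ∀ {k n} → Carrier → Vec Carrier n → Λ k
  steps x []       = 𝟙
  steps x (y ∷ ys) = wedge (λ j → powers y (suc j) - powers x (suc j)) (steps y ys)

  -- Subtracting consecutive rows clears the column of ones.
  wedges-steps : ∀ {k n} x (xs : Vec Carrier n) →
    wedges {suc k} powers (x ∷ xs) ≡ (wedge (powers x ∘ suc) (steps x xs) ∧+ steps x xs)
  wedges-steps x []       = cong (wedge (powers x ∘ suc) 𝟙 ∧+_)
    (trans (cong₂ _⊖_ (1-· 𝟙) (wedge-𝟘 _)) (⊖-𝟘 𝟙))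
  wedges-steps {k} x (y ∷ ys) = begin
    wedge (powers x) (wedges powers (y ∷ ys))
      ≡⟨ cong (wedge (powers x)) (wedges-steps y ys) ⟩
    u x (u y S) ∧+ (1# · u y S ⊖ u x S)
      ≡⟨ cong₂ _∧+_ (sym first) second ⟩
    u x (steps x (y ∷ ys)) ∧+ steps x (y ∷ ys) ∎
    where
    u : Carrier → Λ k → Λ k
    u z = wedge (powers z ∘ suc)
    S = steps y ys
    second : 1# · u y S ⊖ u x S ≡ steps x (y ∷ ys)
    second = trans (cong (_⊖ u x S) (1-· (u y S))) (sym (minus-wedge _ _ S))
    -- Subtracting the row of x from another row is invisible once the row of x is wedged on.
    first : u x (steps x (y ∷ ys)) ≡ u x (u y S)
    first = begin
      u x (steps x (y ∷ ys))      ≡⟨ cong (u x) (minus-wedge _ _ S) ⟩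
      u x (u y S ⊖ u x S)         ≡⟨ wedge-⊖ _ (u y S) (u x S) ⟩
      u x (u y S) ⊖ u x (u x S)   ≡⟨ cong (u x (u y S) ⊖_) (wedge-self _ S) ⟩
      u x (u y S) ⊖ 𝟘             ≡⟨ ⊖-𝟘 _ ⟩
      u x (u y S)                 ∎

  volume-steps : ∀ {n} x (xs : Vec Carrier n) → volume (steps {n} x xs) ≡ vandermonde (x ∷ xs)
  volume-steps x xs = trans (cong volume (sym (wedges-steps x xs))) (volume-wedges (x ∷ xs))

-- Generating functions of triangles

module Sums (A : ℤ-Algebra) where
  open ℤ-Algebra A
  open Solver A using (solve; con; _:+_; _:*_; _:-_; :-_; _:=_)
  open ≡-Reasoning

  ∑ : ∀ {B : Set} → List B → (B → Carrier) → Carrier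
  ∑ []       f = 0#
  ∑ (x ∷ xs) f = f x + ∑ xs f

  ∑-cong : ∀ {B : Set} {f g : B → Carrier} xs → (∀ {x} → x ∈ xs → f x ≡ g x) → ∑ xs f ≡ ∑ xs g
  ∑-cong []       eq = refl
  ∑-cong (x ∷ xs) eq = cong₂ _+_ (eq (here refl)) (∑-cong xs (eq ∘ there))

  ∑-++ : ∀ {B : Set} (f : B → Carrier) xs ys → ∑ (xs ++ ys) f ≡ ∑ xs f + ∑ ys f
  ∑-++ f []       ys = solve 1 (λ s → s := con (pos 0) :+ s) refl (∑ ys f)
  ∑-++ f (x ∷ xs) ys = trans (cong (f x +_) (∑-++ f xs ys))
    (solve 3 (λ x s t → x :+ (s :+ t) := (x :+ s) :+ t) refl (f x) (∑ xs f) (∑ ys f))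

  ∑-map : ∀ {B C : Set} (f : C → Carrier) (g : B → C) xs → ∑ (List.map g xs) f ≡ ∑ xs (f ∘ g)
  ∑-map f g []       = refl
  ∑-map f g (x ∷ xs) = cong (_ +_) (∑-map f g xs)

  *-∑ : ∀ {B : Set} c (f : B → Carrier) xs → ∑ xs (λ x → c * f x) ≡ c * ∑ xs f
  *-∑ c f []       = solve 1 (λ c → con (pos 0) := c :* con (pos 0)) refl c
  *-∑ c f (x ∷ xs) = trans (cong (c * f x +_) (*-∑ c f xs))
    (solve 3 (λ c x s → c :* x :+ c :* s := c :* (x :+ s)) refl c (f x) (∑ xs f))

  ∑-* : ∀ {B : Set} c (f : B → Carrier) xs → ∑ xs (λ x → f x * c) ≡ ∑ xs f * c
  ∑-* c f []       = solve 1 (λ c → con (pos 0) := con (pos 0) :* c) refl c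
  ∑-* c f (x ∷ xs) = trans (cong (f x * c +_) (∑-* c f xs))
    (solve 3 (λ c x s → x :* c :+ s :* c := (x :+ s) :* c) refl c (f x) (∑ xs f))

  ∑-cartesianProductWith : ∀ {B C D : Set} (f : D → Carrier) (g : B → C → D) xs ys →
    ∑ (cartesianProductWith g xs ys) f ≡ ∑ xs (λ x → ∑ ys (λ y → f (g x y)))
  ∑-cartesianProductWith f g []       ys = refl
  ∑-cartesianProductWith f g (x ∷ xs) ys =
    trans (∑-++ f (List.map (g x) ys) _) (cong₂ _+_ (∑-map f (g x) ys) (∑-cartesianProductWith f g xs ys))

  ∑-pairs : ∀ {B C : Set} (f : B × C → Carrier) xs (ys : B → List C) →
    ∑ (pairs xs ys) f ≡ ∑ xs (λ x → ∑ (ys x) (λ y → f (x , y)))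
  ∑-pairs f []       ys = refl
  ∑-pairs f (x ∷ xs) ys =
    trans (∑-++ f (List.map (x ,_) (ys x)) _) (cong₂ _+_ (∑-map f (x ,_) (ys x)) (∑-pairs f xs ys))

  ∑-product : ∀ {B C D : Set} (g : B → C → D) (h : D → Carrier) (f₁ : B → Carrier) (f₂ : C → Carrier) →
    (∀ x y → h (g x y) ≡ f₁ x * f₂ y) →
    ∀ xs ys → ∑ (cartesianProductWith g xs ys) h ≡ ∑ xs f₁ * ∑ ys f₂
  ∑-product g h f₁ f₂ split xs ys = begin
    ∑ (cartesianProductWith g xs ys) h            ≡⟨ ∑-cartesianProductWith h g xs ys ⟩
    ∑ xs (λ x → ∑ ys (λ y → h (g x y)))           ≡⟨ ∑-cong xs (λ {x} _ → trans (∑-cong ys (λ {y} _ → split x y)) (*-∑ (f₁ x) f₂ ys)) ⟩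
    ∑ xs (λ x → f₁ x * ∑ ys f₂)                   ≡⟨ ∑-* (∑ ys f₂) f₁ xs ⟩
    ∑ xs f₁ * ∑ ys f₂                             ∎

  telescope : ∀ (F : ℕ → Carrier) (g : ℕ → ℕ) h → (∀ i → h (g i) ≡ F (suc i) - F i) →
    ∀ l → ∑ (applyUpTo g l) h ≡ F l - F 0
  telescope F g h eq zero    = solve 1 (λ x → con (pos 0) := x :- x) refl (F 0)
  telescope F g h eq (suc l) = trans (cong₂ _+_ (eq 0) (telescope (F ∘ suc) (g ∘ suc) h (eq ∘ suc) l))
    (solve 3 (λ x y z → (y :- x) :+ (z :- y) := z :- x) refl (F 0) (F 1) (F (suc l)))

  -- The discrete fundamental theorem of calculus. For a > b the range is empty while F b - F a need
  -- not vanish; this is why diagonals are kept sorted throughout.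
  ∑-range : ∀ (F h : ℕ → Carrier) → (∀ v → h v ≡ F (suc v) - F v) →
    ∀ {a b} → a ≤ b → ∑ (range a b) h ≡ F b - F a
  ∑-range F h eq {a} {b} a≤b = trans
    (telescope (λ i → F (a ℕ.+ i)) (a ℕ.+_) h (λ i → trans (eq (a ℕ.+ i)) (cong (λ j → F j - F (a ℕ.+ i)) (sym (ℕₚ.+-suc a i)))) (b ∸ a))
    (cong₂ (λ i j → F i - F j) (ℕₚ.m+[n∸m]≡n a≤b) (ℕₚ.+-identityʳ a))

module GeneratingFunctions
  (A : ℤ-Algebra)
  (τ : ℕ → ℤ-Algebra.Carrier A)
  (τ²≡0 : ∀ v → ℤ-Algebra._*_ A (τ v) (τ v) ≡ ℤ-Algebra.0# A)
  where
  open ℤ-Algebra A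
  open Solver A using (solve; con; _:+_; _:*_; _:-_; :-_; _:=_)
  open Exterior A
  open Vandermonde A
  open Sums A
  open ≡-Reasoning

  X : ℕ → Carrier
  X zero    = 0#
  X (suc v) = X v + τ v

  monomial : List ℕ → Carrier
  monomial []       = 1#
  monomial (v ∷ vs) = τ v * monomial vs

  monomial-++ : ∀ us vs → monomial (us ++ vs) ≡ monomial us * monomial vs
  monomial-++ []       vs = solve 1 (λ m → m := con (pos 1) :* m) refl (monomial vs)
  monomial-++ (u ∷ us) vs = trans (cong (τ u *_) (monomial-++ us vs))
    (solve 3 (λ u x y → u :* (x :* y) := (u :* x) :* y) refl (τ u) (monomial us) (monomial vs))

  ∑-τ : ∀ {a b} → a ≤ b → ∑ (range a b) τ ≡ X b - X a
  ∑-τ = ∑-range X τ (λ v → solve 2 (λ x t → t := (x :+ t) :- x) refl (X v) (τ v))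

  box-sum : ∀ {n a} {e : Vec ℕ n} → All (a ≤_) e → ∑ (box a e) (monomial ∘ toList) ≡ differences (X a) (map X e)
  box-sum []                                  = solve 0 (con (pos 1) :+ con (pos 0) := con (pos 1)) refl
  box-sum {a = a} {b ∷ e} (a≤b ∷ a≤e) = begin
    ∑ (box a (b ∷ e)) (monomial ∘ toList)                  ≡⟨ ∑-product _∷_ (monomial ∘ toList) τ (monomial ∘ toList) (λ _ _ → refl) (range a b) (box a e) ⟩
    ∑ (range a b) τ * ∑ (box a e) (monomial ∘ toList)      ≡⟨ cong₂ _*_ (∑-τ a≤b) (box-sum a≤e) ⟩
    (X b - X a) * differences (X a) (map X e)              ∎

  -- Once the diagonal is fixed the cells are independent, and the cell (i, j) contributes the
  -- factor ∑ τ over [eᵢ, eⱼ), which is X eⱼ - X eᵢ.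
  selberg-sum : ∀ {n} {e : Vec ℕ n} → Sorted e → ∑ (selbergTriangles e) (monomial ∘ entries) ≡ vandermonde (map X e)
  selberg-sum []                         = solve 0 (con (pos 1) :+ con (pos 0) := con (pos 1)) refl
  selberg-sum {e = a ∷ e} (a≤e ∷ sorted) = begin
    ∑ (selbergTriangles (a ∷ e)) (monomial ∘ entries)
      ≡⟨ ∑-product _,_ (monomial ∘ entries) (monomial ∘ toList) (monomial ∘ entries) (λ y T → monomial-++ (toList y) (entries T)) (box a e) (selbergTriangles e) ⟩
    ∑ (box a e) (monomial ∘ toList) * ∑ (selbergTriangles e) (monomial ∘ entries)
      ≡⟨ cong₂ _*_ (box-sum a≤e) (selberg-sum sorted) ⟩
    vandermonde (map X (a ∷ e)) ∎

  -- Arbitrary functionals are needed besides `volume`, since the induction in `interlacing-sum`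
  -- absorbs the rows already chosen into φ.
  record Linear {k} (φ : Λ k → Carrier) : Set where
    field
      respects-⊕ : ∀ x y → φ (x ⊕ y) ≡ φ x + φ y
      respects-· : ∀ c x → φ (c · x) ≡ c * φ x
  open Linear

  volume-linear : ∀ {k} → Linear (volume {k})
  volume-linear = record { respects-⊕ = volume-⊕ ; respects-· = volume-· }

  wedge-linear : ∀ {k} {φ : Λ k → Carrier} → Linear φ → ∀ v → Linear (φ ∘ wedge v)
  wedge-linear {φ = φ} lin v = record
    { respects-⊕ = λ x y → trans (cong φ (wedge-⊕ v x y)) (respects-⊕ lin _ _)
    ; respects-· = λ c x → trans (cong φ (wedge-· v c x)) (respects-· lin c _)
    }

  -- The Vandermonde row (1, X v, (X v)², ...) integrated against the weights `τ v`.
  moments : List ℕ → ℕ → Carrier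
  moments vs j = ∑ vs (λ v → τ v * powers (X v) j)

  wedge-moments : ∀ {k} {φ : Λ k → Carrier} → Linear φ → ∀ vs x →
    φ (wedge (moments vs) x) ≡ ∑ vs (λ v → τ v * φ (wedge (powers (X v)) x))
  wedge-moments {φ = φ} lin [] x = begin
    φ (wedge (λ _ → 0#) x)        ≡⟨ cong φ (wedge-cong (λ _ → solve 0 (con (pos 0) := con (pos 0) :* con (pos 0)) refl) x) ⟩
    φ (wedge (λ _ → 0# * 0#) x)   ≡⟨ cong φ (*-wedge 0# (λ _ → 0#) x) ⟩
    φ (0# · wedge (λ _ → 0#) x)   ≡⟨ respects-· lin 0# _ ⟩
    0# * φ (wedge (λ _ → 0#) x)   ≡⟨ solve 1 (λ x → con (pos 0) :* x := con (pos 0)) refl _ ⟩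
    0#                            ∎
  wedge-moments {φ = φ} lin (v ∷ vs) x = begin
    φ (wedge (λ j → τ v * powers (X v) j + moments vs j) x)
      ≡⟨ cong φ (+-wedge _ (moments vs) x) ⟩
    φ (wedge (λ j → τ v * powers (X v) j) x ⊕ wedge (moments vs) x)
      ≡⟨ respects-⊕ lin _ _ ⟩
    φ (wedge (λ j → τ v * powers (X v) j) x) + φ (wedge (moments vs) x)
      ≡⟨ cong₂ _+_ (trans (cong φ (*-wedge (τ v) (powers (X v)) x)) (respects-· lin (τ v) _)) (wedge-moments lin vs x) ⟩
    τ v * φ (wedge (powers (X v)) x) + ∑ vs (λ v → τ v * φ (wedge (powers (X v)) x)) ∎

  integrals : ∀ {k n} → ℕ → Vec ℕ n → Λ k
  integrals a []      = 𝟙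
  integrals a (b ∷ e) = wedge (moments (range a b)) (integrals b e)

  -- Each entry of `y` determines one row and has a range fixed by `e` alone, so multilinearity
  -- moves every sum into its own row.
  interlacing-sum : ∀ {k n} {φ : Λ k → Carrier} → Linear φ → ∀ a (e : Vec ℕ n) →
    ∑ (interlacing a e) (λ y → monomial (toList y) * φ (wedges powers (map X y))) ≡ φ (integrals a e)
  interlacing-sum {φ = φ} lin a []      = solve 1 (λ x → con (pos 1) :* x :+ con (pos 0) := x) refl (φ 𝟙)
  interlacing-sum {φ = φ} lin a (b ∷ e) = begin
    ∑ (interlacing a (b ∷ e)) (λ y → monomial (toList y) * φ (wedges powers (map X y)))
      ≡⟨ ∑-cartesianProductWith _ _∷_ (range a b) (interlacing b e) ⟩
    ∑ (range a b) (λ v → ∑ (interlacing b e) (λ y → (τ v * monomial (toList y)) * φ (wedge (powers (X v)) (wedges powers (map X y)))))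
      ≡⟨ ∑-cong (range a b) (λ {v} _ → begin
           ∑ (interlacing b e) (λ y → (τ v * monomial (toList y)) * φ (wedge (powers (X v)) (wedges powers (map X y))))
             ≡⟨ ∑-cong (interlacing b e) (λ _ → solve 3 (λ x y z → (x :* y) :* z := x :* (y :* z)) refl (τ v) _ _) ⟩
           ∑ (interlacing b e) (λ y → τ v * (monomial (toList y) * φ (wedge (powers (X v)) (wedges powers (map X y)))))
             ≡⟨ *-∑ (τ v) _ (interlacing b e) ⟩
           τ v * ∑ (interlacing b e) (λ y → monomial (toList y) * φ (wedge (powers (X v)) (wedges powers (map X y))))
             ≡⟨ cong (τ v *_) (interlacing-sum (wedge-linear lin (powers (X v))) b e) ⟩
           τ v * φ (wedge (powers (X v)) (integrals b e)) ∎) ⟩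
    ∑ (range a b) (λ v → τ v * φ (wedge (powers (X v)) (integrals b e)))
      ≡⟨ wedge-moments lin (range a b) (integrals b e) ⟨
    φ (integrals a (b ∷ e)) ∎

  ι-suc : ∀ k → ι (pos (suc k)) ≡ 1# + ι (pos k)
  ι-suc k = ι-+ (pos 1) (pos k)

  -- The binomial theorem stops after the linear term. This makes the increment of a power of X
  -- equal to its derivative times τ, without error.
  powers-+ : ∀ x t k → t * t ≡ 0# → powers (x + t) (suc k) ≡ powers x (suc k) + ι (pos (suc k)) * (t * powers x k)
  powers-+ x t zero    t²≡0 =
    solve 2 (λ x t → (x :+ t) :* con (pos 1) := x :* con (pos 1) :+ con (pos 1) :* (t :* con (pos 1))) refl x t
  powers-+ x t (suc k) t²≡0 = begin
    (x + t) * powers (x + t) (suc k)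
      ≡⟨ cong ((x + t) *_) (powers-+ x t k t²≡0) ⟩
    (x + t) * (x * p + i * (t * p))
      -- The second-order part is isolated as a multiple of `t * t`.
      ≡⟨ solve 4 (λ x t p i → (x :+ t) :* (x :* p :+ i :* (t :* p)) := (x :* (x :* p) :+ (con (pos 1) :+ i) :* (t :* (x :* p))) :+ (t :* t) :* (i :* p)) refl x t p i ⟩
    x * (x * p) + (1# + i) * (t * (x * p)) + (t * t) * (i * p)
      ≡⟨ cong (λ s → x * (x * p) + (1# + i) * (t * (x * p)) + s * (i * p)) t²≡0 ⟩
    x * (x * p) + (1# + i) * (t * (x * p)) + 0# * (i * p)
      ≡⟨ solve 2 (λ s y → s :+ con (pos 0) :* y := s) refl _ (i * p) ⟩
    x * (x * p) + (1# + i) * (t * (x * p))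
      ≡⟨ cong (λ s → x * (x * p) + s * (t * (x * p))) (ι-suc (suc k)) ⟨
    x * (x * p) + ι (pos (suc (suc k))) * (t * (x * p)) ∎
    where
    p = powers x k
    i = ι (pos (suc k))

  -- Column weights that replace the division by j + 1 in the integral of xʲ.
  successors : ℕ → Carrier
  successors j = ι (pos (suc j))

  -- ∫ xʲ dx, exact because τ v squares to zero.
  scale-moments : ∀ {a b} → a ≤ b → scale successors (moments (range a b)) ≗ λ j → powers (X b) (suc j) - powers (X a) (suc j)
  scale-moments {a} {b} a≤b j = begin
    successors j * moments (range a b) j
      ≡⟨ *-∑ (successors j) _ (range a b) ⟨
    ∑ (range a b) (λ v → successors j * (τ v * powers (X v) j))
      ≡⟨ ∑-range (λ v → powers (X v) (suc j)) _ (λ v → sym (trans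
           (cong (_- powers (X v) (suc j)) (powers-+ (X v) (τ v) j (τ²≡0 v)))
           (solve 2 (λ x y → (x :+ y) :- x := y) refl _ _))) a≤b ⟩
    powers (X b) (suc j) - powers (X a) (suc j) ∎

  scaleΛ-integrals : ∀ {k n a} {e : Vec ℕ n} → Sorted (a ∷ e) → scaleΛ successors (integrals {k} a e) ≡ steps (X a) (map X e)
  scaleΛ-integrals {e = []}            _                         = scaleΛ-𝟙 successors
  scaleΛ-integrals {a = a} {b ∷ e} ((a≤b ∷ _) ∷ sorted) = begin
    scaleΛ successors (wedge (moments (range a b)) (integrals b e))
      ≡⟨ scaleΛ-wedge successors (moments (range a b)) (integrals b e) ⟩
    wedge (scale successors (moments (range a b))) (scaleΛ successors (integrals b e))
      ≡⟨ cong (wedge _) (scaleΛ-integrals sorted) ⟩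
    wedge (scale successors (moments (range a b))) (steps (X b) (map X e))
      ≡⟨ wedge-cong (scale-moments a≤b) (steps (X b) (map X e)) ⟩
    steps (X a) (map X (b ∷ e)) ∎

  ∏<-suc : ∀ k c → ∏< (suc k) c ≡ c k * ∏< k c
  ∏<-suc zero    c = refl
  ∏<-suc (suc k) c = trans (cong (c 0 *_) (∏<-suc k (c ∘ suc)))
    (solve 3 (λ x y z → x :* (y :* z) := y :* (x :* z)) refl (c 0) (c (suc k)) _)

  ∏<-successors : ∀ k → ∏< k successors ≡ ι (pos (k !))
  ∏<-successors zero    = refl
  ∏<-successors (suc k) = begin
    ∏< (suc k) successors             ≡⟨ ∏<-suc k successors ⟩
    ι (pos (suc k)) * ∏< k successors     ≡⟨ cong (ι (pos (suc k)) *_) (∏<-successors k) ⟩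
    ι (pos (suc k)) * ι (pos (k !))         ≡⟨ ι-* (pos (suc k)) (pos (k !)) ⟨
    ι (pos (suc k) ℤ.* pos (k !))           ≡⟨ cong ι (ℤₚ.pos-* (suc k) (k !)) ⟨
    ι (pos (suc k !))                   ∎

  -- Discrete Dixon–Anderson integral with unit exponents.
  vandermonde-interlacing : ∀ {n a} {e : Vec ℕ n} → Sorted (a ∷ e) →
    ι (pos (n !)) * ∑ (interlacing a e) (λ y → monomial (toList y) * vandermonde (map X y)) ≡ vandermonde (map X (a ∷ e))
  vandermonde-interlacing {n} {a} {e} sorted = begin
    ι (pos (n !)) * ∑ (interlacing a e) (λ y → monomial (toList y) * vandermonde (map X y))
      ≡⟨ cong₂ _*_ (∏<-successors n) (∑-cong (interlacing a e) (λ {y} _ → cong (monomial (toList y) *_) (volume-wedges (map X y)))) ⟨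
    ∏< n successors * ∑ (interlacing a e) (λ y → monomial (toList y) * volume (wedges {n} powers (map X y)))
      ≡⟨ cong (∏< n successors *_) (interlacing-sum volume-linear a e) ⟩
    ∏< n successors * volume (integrals {n} a e)
      -- The factorial is read as the determinant of the column scaling, which then turns the
      -- integrated rows into differences of powers.
      ≡⟨ volume-scaleΛ successors (integrals a e) ⟨
    volume (scaleΛ successors (integrals {n} a e))
      ≡⟨ cong volume (scaleΛ-integrals sorted) ⟩
    volume (steps {n} (X a) (map X e))
      ≡⟨ volume-steps (X a) (map X e) ⟩
    vandermonde (map X (a ∷ e)) ∎

  young-sum : ∀ {n} {e : Vec ℕ n} → Sorted e →
    ι (pos (superfactorial n)) * ∑ (youngTriangles e) (monomial ∘ entries) ≡ vandermonde (map X e)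
  young-sum {e = []} [] = solve 0 (con (pos 1) :* (con (pos 1) :+ con (pos 0)) := con (pos 1)) refl
  young-sum {suc n} {a ∷ e} sorted = begin
    ι (pos (superfactorial (suc n))) * ∑ (youngTriangles (a ∷ e)) (monomial ∘ entries)
      ≡⟨ cong₂ _*_ ι-superfactorial (trans (∑-pairs _ (interlacing a e) youngTriangles)
           (∑-cong (interlacing a e) (λ {y} _ → trans
             (∑-cong (youngTriangles y) (λ {T} _ → monomial-++ (toList y) (entries T)))
             (*-∑ (monomial (toList y)) (monomial ∘ entries) (youngTriangles y))))) ⟩
    (ι (pos (n !)) * ι (pos (superfactorial n))) * ∑ (interlacing a e) (λ y → monomial (toList y) * Y y)
      ≡⟨ solve 3 (λ x y z → (x :* y) :* z := x :* (y :* z)) refl _ _ _ ⟩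
    ι (pos (n !)) * (ι (pos (superfactorial n)) * ∑ (interlacing a e) (λ y → monomial (toList y) * Y y))
      ≡⟨ cong (ι (pos (n !)) *_) (trans (sym (*-∑ _ _ (interlacing a e))) (∑-cong (interlacing a e) (λ {y} y∈ → trans
           (solve 3 (λ x y z → x :* (y :* z) := y :* (x :* z)) refl _ (monomial (toList y)) _)
           (cong (monomial (toList y) *_) (young-sum (interlacing-sorted sorted y∈)))))) ⟩
    ι (pos (n !)) * ∑ (interlacing a e) (λ y → monomial (toList y) * vandermonde (map X y))
      ≡⟨ vandermonde-interlacing sorted ⟩
    vandermonde (map X (a ∷ e)) ∎
    where
    Y : Vec ℕ n → Carrier
    Y y = ∑ (youngTriangles y) (monomial ∘ entries)
    ι-superfactorial : ι (pos (superfactorial (suc n))) ≡ ι (pos (n !)) * ι (pos (superfactorial n))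
    ι-superfactorial = trans (cong (ι ∘ pos) (superfactorial-suc n))
      (trans (cong ι (ℤₚ.pos-* (n !) (superfactorial n))) (ι-* (pos (n !)) (pos (superfactorial n))))

-- Square-free polynomials

integers : ℤ-Algebra
integers = record
  { isCommutativeRing = ℤₚ.+-*-isCommutativeRing
  ; ι     = id
  ; ι-+   = λ _ _ → refl
  ; ι-*   = λ _ _ → refl
  ; ι-neg = λ _ → refl
  }

-- A[ε]/(ε²), with (a , b) for a + b ε. Iterating it adjoins the variables one at a time, and the
-- last one carries the largest value.
dualNumbers : ℤ-Algebra → ℤ-Algebra
dualNumbers A = record
  { Carrier = Carrier × Carrier
  ; _+_     = λ (a , b) (c , d) → a + c , b + d
  ; _*_     = λ (a , b) (c , d) → a * c , a * d + b * c
  ; -_      = λ (a , b) → - a , - b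
  ; ι       = λ z → ι z , 0#
  ; isCommutativeRing = record
    { isRing = record
      { +-isAbelianGroup = record
        { isGroup = record
          { isMonoid = record
            { isSemigroup = record
              { isMagma = record { isEquivalence = isEquivalence ; ∙-cong = cong₂ _ }
              ; assoc   = λ (a , b) (c , d) (e , f) → cong₂ _,_ (+-assoc a c e) (+-assoc b d f)
              }
            ; identity = (λ (a , b) → cong₂ _,_ (+-identityˡ a) (+-identityˡ b))
                       , (λ (a , b) → cong₂ _,_ (+-identityʳ a) (+-identityʳ b))
            }
          ; inverse = (λ (a , b) → cong₂ _,_ (-‿inverseˡ a) (-‿inverseˡ b))
                    , (λ (a , b) → cong₂ _,_ (-‿inverseʳ a) (-‿inverseʳ b))
          ; ⁻¹-cong = cong (λ (a , b) → - a , - b)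
          }
        ; comm = λ (a , b) (c , d) → cong₂ _,_ (+-comm a c) (+-comm b d)
        }
      ; *-cong     = cong₂ _
      ; *-assoc    = λ (a , b) (c , d) (e , f) → cong₂ _,_ (*-assoc a c e)
          (solve 6 (λ a b c d e f → (a :* c) :* f :+ (a :* d :+ b :* c) :* e := a :* (c :* f :+ d :* e) :+ b :* (c :* e)) refl a b c d e f)
      ; *-identity = (λ (a , b) → cong₂ _,_ (*-identityˡ a) (solve 2 (λ a b → con (pos 1) :* b :+ con (pos 0) :* a := b) refl a b))
                   , (λ (a , b) → cong₂ _,_ (*-identityʳ a) (solve 2 (λ a b → a :* con (pos 0) :+ b :* con (pos 1) := b) refl a b))
      ; distrib    = (λ (a , b) (c , d) (e , f) → cong₂ _,_ (distribˡ a c e)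
                        (solve 6 (λ a b c d e f → a :* (d :+ f) :+ b :* (c :+ e) := (a :* d :+ b :* c) :+ (a :* f :+ b :* e)) refl a b c d e f))
                   , (λ (a , b) (c , d) (e , f) → cong₂ _,_ (distribʳ a c e)
                        (solve 6 (λ a b c d e f → (c :+ e) :* b :+ (d :+ f) :* a := (c :* b :+ d :* a) :+ (e :* b :+ f :* a)) refl a b c d e f))
      }
    ; *-comm = λ (a , b) (c , d) → cong₂ _,_ (*-comm a c)
        (solve 4 (λ a b c d → a :* d :+ b :* c := c :* b :+ d :* a) refl a b c d)
    }
  ; ι-+   = λ a b → cong₂ _,_ (ι-+ a b) (sym (+-identityˡ 0#))
  ; ι-*   = λ a b → cong₂ _,_ (ι-* a b) (solve 2 (λ a b → con (pos 0) := a :* con (pos 0) :+ con (pos 0) :* b) refl (ι a) (ι b))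
  ; ι-neg = λ a → cong₂ _,_ (ι-neg a) (solve 0 (con (pos 0) := :- con (pos 0)) refl)
  }
  where
  open ℤ-Algebra A
  open IsCommutativeRing isCommutativeRing
    using (+-assoc; +-identityˡ; +-identityʳ; -‿inverseˡ; -‿inverseʳ; +-comm; *-assoc; *-identityˡ; *-identityʳ; distribˡ; distribʳ; *-comm)
  open Solver A using (solve; con; _:+_; _:*_; :-_; _:=_)

-- ℤ[τ₁, …, τ_N] / (τ₁², …, τ_N²).
squareFree : ℕ → ℤ-Algebra
squareFree zero    = integers
squareFree (suc N) = dualNumbers (squareFree N)

topCoefficient : ∀ N → ℤ-Algebra.Carrier (squareFree N) → ℤ
topCoefficient zero    x       = x
topCoefficient (suc N) (_ , b) = topCoefficient N b

-- τ N v = 0 unless 1 ≤ v ≤ N.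
τ : ∀ N → ℕ → ℤ-Algebra.Carrier (squareFree N)
τ zero    v = pos 0
τ (suc N) v with v ℕ.≟ suc N
... | yes _ = ℤ-Algebra.0# (squareFree N) , ℤ-Algebra.1# (squareFree N)
... | no  _ = τ N v , ℤ-Algebra.0# (squareFree N)

τ²≡0 : ∀ N v → (let open ℤ-Algebra (squareFree N)) → τ N v * τ N v ≡ 0#
τ²≡0 zero    v = refl
τ²≡0 (suc N) v with v ℕ.≟ suc N
... | yes _ = cong₂ _,_ (solve 0 (con (pos 0) :* con (pos 0) := con (pos 0)) refl)
                        (solve 0 (con (pos 0) :* con (pos 1) :+ con (pos 1) :* con (pos 0) := con (pos 0)) refl)
  where open Solver (squareFree N)
... | no  _ = cong₂ _,_ (τ²≡0 N v) (solve 1 (λ t → t :* con (pos 0) :+ con (pos 0) :* t := con (pos 0)) refl (τ N v))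
  where open Solver (squareFree N)

module SquareFree (N : ℕ) where
  open ℤ-Algebra (squareFree N) public
  open Sums (squareFree N) public
  open GeneratingFunctions (squareFree N) (τ N) (τ²≡0 N) public

topCoefficient-+ : ∀ N x y → (let open SquareFree N) → topCoefficient N (x + y) ≡ topCoefficient N x ℤ.+ topCoefficient N y
topCoefficient-+ zero    x       y       = refl
topCoefficient-+ (suc N) (_ , b) (_ , d) = topCoefficient-+ N b d

topCoefficient-0 : ∀ N → (let open SquareFree N) → topCoefficient N 0# ≡ pos 0
topCoefficient-0 zero    = refl
topCoefficient-0 (suc N) = topCoefficient-0 N

topCoefficient-ι : ∀ N z x → (let open SquareFree N) → topCoefficient N (ι z * x) ≡ z ℤ.* topCoefficient N x
topCoefficient-ι zero    z x       = refl
topCoefficient-ι (suc N) z (a , b) = trans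
  (cong (topCoefficient N) (solve 3 (λ z a b → z :* b :+ con (pos 0) :* a := z :* b) refl (ι z) a b))
  (topCoefficient-ι N z b)
  where
  open ℤ-Algebra (squareFree N)
  open Solver (squareFree N) using (solve; con; _:+_; _:*_; _:=_)

-- Multiplicities of values and top coefficients of monomials

count : ℕ → List ℕ → ℕ
count v []       = 0
count v (u ∷ us) with u ℕ.≟ v
... | yes _ = suc (count v us)
... | no  _ = count v us

without : ℕ → List ℕ → List ℕ
without v []       = []
without v (u ∷ us) with u ℕ.≟ v
... | yes _ = without v us
... | no  _ = u ∷ without v us

count-without : ∀ {u v} → u ≢ v → ∀ us → count u (without v us) ≡ count u us
count-without u≢v [] = refl
count-without {u} {v} u≢v (w ∷ us) with w ℕ.≟ v
count-without {u} {v} u≢v (w ∷ us) | yes refl with w ℕ.≟ u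
... | yes refl = ⊥-elim (u≢v refl)
... | no  _    = count-without u≢v us
count-without {u} {v} u≢v (w ∷ us) | no _ with w ℕ.≟ u
... | yes _ = cong suc (count-without u≢v us)
... | no  _ = count-without u≢v us

∈-without⁺ : ∀ {u v us} → u ≢ v → u ∈ us → u ∈ without v us
∈-without⁺ {u} {v} {w ∷ us} u≢v u∈ with w ℕ.≟ v | u∈
... | yes refl | here refl  = ⊥-elim (u≢v refl)
... | yes _    | there u∈us = ∈-without⁺ u≢v u∈us
... | no  _    | here refl  = here refl
... | no  _    | there u∈us = there (∈-without⁺ u≢v u∈us)

∈-without⁻ : ∀ {u v} us → u ∈ without v us → u ∈ us × u ≢ v
∈-without⁻ {u} {v} (w ∷ us) u∈ with w ℕ.≟ v | u∈
... | yes _  | u∈us       = let (u∈ , u≢v) = ∈-without⁻ us u∈us in there u∈ , u≢v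
... | no w≢v | here refl  = here refl , w≢v
... | no _   | there u∈us = let (u∈ , u≢v) = ∈-without⁻ us u∈us in there u∈ , u≢v

-- Indicators giving εᶜ = `[ c ≡0]` + `[ c ≡1]` ε, since higher powers vanish.
[_≡0] [_≡1] : ℕ → ℤ
[ zero  ≡0] = pos 1
[ suc _ ≡0] = pos 0
[ zero  ≡1] = pos 0
[ suc c ≡1] = [ c ≡0]

monomial-suc : ∀ N us → (let open SquareFree N) →
  SquareFree.monomial (suc N) us ≡
  (ι [ count (suc N) us ≡0] * monomial (without (suc N) us) , ι [ count (suc N) us ≡1] * monomial (without (suc N) us))
monomial-suc N [] = cong₂ _,_ (solve 0 (con (pos 1) := con (pos 1) :* con (pos 1)) refl) (solve 0 (con (pos 0) := con (pos 0) :* con (pos 1)) refl)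
  where open Solver (squareFree N)
monomial-suc N (u ∷ us) with u ℕ.≟ suc N | monomial-suc N us
... | yes _ | eq rewrite eq = cong₂ _,_
    (solve 2 (λ x m → con (pos 0) :* (x :* m) := con (pos 0) :* m) refl (ι [ count (suc N) us ≡0]) (monomial (without (suc N) us)))
    (solve 3 (λ x y m → con (pos 0) :* (y :* m) :+ con (pos 1) :* (x :* m) := x :* m) refl
      (ι [ count (suc N) us ≡0]) (ι [ count (suc N) us ≡1]) (monomial (without (suc N) us)))
  where
  open SquareFree N
  open Solver (squareFree N) using (solve; con; _:+_; _:*_; _:=_)
... | no _ | eq rewrite eq = cong₂ _,_
    (solve 3 (λ x m t → t :* (x :* m) := x :* (t :* m)) refl (ι [ count (suc N) us ≡0]) (monomial (without (suc N) us)) (τ N u))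
    (solve 4 (λ x y m t → t :* (y :* m) :+ con (pos 0) :* (x :* m) := y :* (t :* m)) refl
      (ι [ count (suc N) us ≡0]) (ι [ count (suc N) us ≡1]) (monomial (without (suc N) us)) (τ N u))
  where
  open SquareFree N
  open Solver (squareFree N) using (solve; con; _:+_; _:*_; _:=_)

topMonomial : ℕ → List ℕ → ℤ
topMonomial N us = topCoefficient N (SquareFree.monomial N us)

topMonomial-suc : ∀ N us → topMonomial (suc N) us ≡ [ count (suc N) us ≡1] ℤ.* topMonomial N (without (suc N) us)
topMonomial-suc N us = trans (cong (topCoefficient (suc N)) (monomial-suc N us))
  (topCoefficient-ι N [ count (suc N) us ≡1] _)

record EachOnce (N : ℕ) (us : List ℕ) : Set where
  field
    bounded : ∀ {v} → v ∈ us → 1 ≤ v × v ≤ N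
    once    : ∀ v → 1 ≤ v → v ≤ N → count v us ≡ 1

topMonomial-0-or-1 : ∀ N us → topMonomial N us ≡ pos 0 ⊎ topMonomial N us ≡ pos 1
topMonomial-0-or-1 zero    []       = inj₂ refl
topMonomial-0-or-1 zero    (u ∷ us) = inj₁ refl
topMonomial-0-or-1 (suc N) us rewrite topMonomial-suc N us with count (suc N) us
... | zero        = inj₁ refl
... | suc (suc _) = inj₁ refl
... | suc zero rewrite ℤₚ.*-identityˡ (topMonomial N (without (suc N) us)) = topMonomial-0-or-1 N (without (suc N) us)

-- Peels off the largest value, whose multiplicity must be one. With no variables left, any
-- remaining entry gives 0, which excludes values out of range.
topMonomial≡1⇒EachOnce : ∀ N us → topMonomial N us ≡ pos 1 → EachOnce N us
topMonomial≡1⇒EachOnce zero [] _ = record { bounded = λ () ; once = λ { v 1≤v v≤0 → ⊥-elim (ℕₚ.<⇒≱ 1≤v v≤0) } }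
topMonomial≡1⇒EachOnce (suc N) us eq rewrite topMonomial-suc N us with count (suc N) us in c≡
... | suc zero = record { bounded = bounded ; once = once }
  where
  module IH = EachOnce (topMonomial≡1⇒EachOnce N (without (suc N) us) (trans (sym (ℤₚ.*-identityˡ _)) eq))
  bounded : ∀ {v} → v ∈ us → 1 ≤ v × v ≤ suc N
  bounded {v} v∈ with v ℕ.≟ suc N
  ... | yes refl = s≤s z≤n , ℕₚ.≤-refl
  ... | no v≢    = let (1≤v , v≤N) = IH.bounded (∈-without⁺ v≢ v∈) in 1≤v , ℕₚ.m≤n⇒m≤1+n v≤N
  once : ∀ v → 1 ≤ v → v ≤ suc N → count v us ≡ 1
  once v 1≤v v≤1+N with v ℕ.≟ suc N
  ... | yes refl = c≡
  ... | no v≢    = trans (sym (count-without v≢ us)) (IH.once v 1≤v (ℕₚ.≤-pred (ℕₚ.≤∧≢⇒< v≤1+N v≢)))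

EachOnce⇒topMonomial≡1 : ∀ N us → EachOnce N us → topMonomial N us ≡ pos 1
EachOnce⇒topMonomial≡1 zero    []       _    = refl
EachOnce⇒topMonomial≡1 zero    (u ∷ us) each = ⊥-elim (case EachOnce.bounded each (here refl) of λ (1≤u , u≤0) → ℕₚ.<⇒≱ 1≤u u≤0)
EachOnce⇒topMonomial≡1 (suc N) us       each = trans (topMonomial-suc N us)
  (cong₂ ℤ._*_ (cong [_≡1] (once (suc N) (s≤s z≤n) ℕₚ.≤-refl)) (EachOnce⇒topMonomial≡1 N (without (suc N) us) record
    { bounded = λ v∈ → let (v∈us , v≢) = ∈-without⁻ us v∈
                           (1≤v , v≤1+N) = bounded v∈us
                       in 1≤v , ℕₚ.≤-pred (ℕₚ.≤∧≢⇒< v≤1+N v≢)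
    ; once    = λ v 1≤v v≤N → trans (count-without (ℕₚ.<⇒≢ (s≤s v≤N)) us) (once v 1≤v (ℕₚ.m≤n⇒m≤1+n v≤N))
    }))
  where open EachOnce each

-- All the coefficients are 0 or 1, so adding them counts the terms whose coefficient is 1.
length-filter-topMonomial : ∀ N {B : Set} (us : B → List ℕ) (xs : List B) → (let open SquareFree N) →
  pos (length (filter (λ x → topMonomial N (us x) ℤ.≟ pos 1) xs)) ≡ topCoefficient N (∑ xs (monomial ∘ us))
length-filter-topMonomial N us []       = sym (topCoefficient-0 N)
length-filter-topMonomial N us (x ∷ xs) rewrite topCoefficient-+ N (SquareFree.monomial N (us x)) (SquareFree.∑ N xs (SquareFree.monomial N ∘ us))
  with topMonomial N (us x) | topMonomial-0-or-1 N (us x) | length-filter-topMonomial N us xs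
... | _ | inj₁ refl | eq = trans eq (sym (ℤₚ.+-identityˡ _))
... | _ | inj₂ refl | eq = cong (ℤ._+_ (pos 1)) eq

-- Lists of triangles and cells

lookup-injective : ∀ {A : Set} {xs : List A} → Unique xs → ∀ i j → List.lookup xs i ≡ List.lookup xs j → i ≡ j
lookup-injective (_ ∷ _)  zero    zero    _  = refl
lookup-injective (x∉ ∷ _) zero    (suc j) eq = ⊥-elim (ListAll.lookup x∉ (∈-lookup j) eq)
lookup-injective (x∉ ∷ _) (suc i) zero    eq = ⊥-elim (ListAll.lookup x∉ (∈-lookup i) (sym eq))
lookup-injective (_ ∷ u)  (suc i) (suc j) eq = cong suc (lookup-injective u i j eq)

∈-pairs⁺ : ∀ {A B : Set} {xs : List A} {ys : A → List B} {x y} → x ∈ xs → y ∈ ys x → (x , y) ∈ pairs xs ys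
∈-pairs⁺ x∈ y∈ = ∈-concatMap⁺ _ (lose x∈ (∈-map⁺ (_ ,_) y∈))

∈-pairs⁻ : ∀ {A B : Set} (xs : List A) {ys : A → List B} {x y} → (x , y) ∈ pairs xs ys → x ∈ xs × y ∈ ys x
∈-pairs⁻ xs xy∈ with find (∈-concatMap⁻ _ {xs = xs} xy∈)
... | _ , x∈ , xy∈′ with ∈-map⁻ _ xy∈′
... | _ , y∈ , refl = x∈ , y∈

pairs-unique : ∀ {A B : Set} {xs : List A} {ys : A → List B} → Unique xs → (∀ x → Unique (ys x)) → Unique (pairs xs ys)
pairs-unique []                              uys = []
pairs-unique {xs = x ∷ xs} {ys} (x∉ ∷ uxs) uys = Uniqueₚ.++⁺
  (Uniqueₚ.map⁺ (cong proj₂) (uys x)) (pairs-unique uxs uys)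
  λ (v∈₁ , v∈₂) → case ∈-map⁻ (x ,_) v∈₁ of λ { (_ , _ , refl) → ListAll.lookup x∉ (proj₁ (∈-pairs⁻ xs v∈₂)) refl }

∈-range⁺ : ∀ {v a b} → a ≤ v → v < b → v ∈ range a b
∈-range⁺ {v} {a} {b} a≤v v<b = subst (_∈ range a b) (ℕₚ.m+[n∸m]≡n a≤v) (∈-applyUpTo⁺ (a ℕ.+_) (ℕₚ.∸-monoˡ-< v<b a≤v))

range-unique : ∀ a b → Unique (range a b)
range-unique a b = Uniqueₚ.applyUpTo⁺₁ (a ℕ.+_) (b ∸ a) (λ i<j _ eq → ℕₚ.<⇒≢ i<j (ℕₚ.+-cancelˡ-≡ a _ _ eq))

singleton-unique : ∀ {A : Set} {x : A} → Unique List.[ x ]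
singleton-unique = [] ∷ []

∷-products-unique : ∀ {A : Set} {n} {xs : List A} {ys : List (Vec A n)} →
  Unique xs → Unique ys → Unique (cartesianProductWith Vec._∷_ xs ys)
∷-products-unique = Uniqueₚ.cartesianProductWith⁺ Vec._∷_ (λ { refl → refl , refl })

box-unique : ∀ {n} a (e : Vec ℕ n) → Unique (box a e)
box-unique a []      = singleton-unique
box-unique a (b ∷ e) = ∷-products-unique (range-unique a b) (box-unique a e)

interlacing-unique : ∀ {n} a (e : Vec ℕ n) → Unique (interlacing a e)
interlacing-unique a []      = singleton-unique
interlacing-unique a (b ∷ e) = ∷-products-unique (range-unique a b) (interlacing-unique b e)

vectors-unique : ∀ {A : Set} n {xs : List A} → Unique xs → Unique (vectors n xs)
vectors-unique zero    u = singleton-unique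
vectors-unique (suc n) u = ∷-products-unique u (vectors-unique n u)

selbergTriangles-unique : ∀ {n} (e : Vec ℕ n) → Unique (selbergTriangles e)
selbergTriangles-unique []      = singleton-unique
selbergTriangles-unique (a ∷ e) = Uniqueₚ.cartesianProduct⁺ (box-unique a e) (selbergTriangles-unique e)

youngTriangles-unique : ∀ {n} (e : Vec ℕ n) → Unique (youngTriangles e)
youngTriangles-unique []      = singleton-unique
youngTriangles-unique (a ∷ e) = pairs-unique (interlacing-unique a e) youngTriangles-unique

∈-box⁺ : ∀ {n} a (e : Vec ℕ n) {y} → (∀ j → a ≤ lookup y j × lookup y j < lookup e j) → y ∈ box a e
∈-box⁺ a []      {[]}    _      = here refl
∈-box⁺ a (b ∷ e) {v ∷ y} bounds = ∈-cartesianProductWith⁺ _∷_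
  (∈-range⁺ (proj₁ (bounds zero)) (proj₂ (bounds zero))) (∈-box⁺ a e (bounds ∘ suc))

∈-box⁻ : ∀ {n} a (e : Vec ℕ n) {y} → y ∈ box a e → ∀ j → a ≤ lookup y j × lookup y j < lookup e j
∈-box⁻ a (b ∷ e) y∈ j with ∈-cartesianProductWith⁻ _∷_ (range a b) (box a e) y∈
∈-box⁻ a (b ∷ e) y∈ zero    | _ , _ , v∈ , _   , refl = ∈-range⁻ a b v∈
∈-box⁻ a (b ∷ e) y∈ (suc j) | _ , _ , _  , y′∈ , refl = ∈-box⁻ a e y′∈ j

∈-interlacing⁺ : ∀ {n} a (e : Vec ℕ n) {y} →
  (∀ i → lookup (a ∷ e) (inject₁ i) ≤ lookup y i × lookup y i < lookup e i) → y ∈ interlacing a e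
∈-interlacing⁺ a []      {[]}    _      = here refl
∈-interlacing⁺ a (b ∷ e) {v ∷ y} bounds = ∈-cartesianProductWith⁺ _∷_
  (∈-range⁺ (proj₁ (bounds zero)) (proj₂ (bounds zero))) (∈-interlacing⁺ b e (bounds ∘ suc))

∈-interlacing⁻ : ∀ {n} a (e : Vec ℕ n) {y} → y ∈ interlacing a e →
  ∀ i → lookup (a ∷ e) (inject₁ i) ≤ lookup y i × lookup y i < lookup e i
∈-interlacing⁻ a (b ∷ e) y∈ i with ∈-cartesianProductWith⁻ _∷_ (range a b) (interlacing b e) y∈
∈-interlacing⁻ a (b ∷ e) y∈ zero    | _ , _ , v∈ , _   , refl = ∈-range⁻ a b v∈
∈-interlacing⁻ a (b ∷ e) y∈ (suc i) | _ , _ , _  , y′∈ , refl = ∈-interlacing⁻ b e y′∈ i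

∈-vectors⁺ : ∀ {A : Set} {n} {xs : List A} {v : Vec A n} → (∀ i → lookup v i ∈ xs) → v ∈ vectors n xs
∈-vectors⁺ {v = []}    _  = here refl
∈-vectors⁺ {v = x ∷ v} v∈ = ∈-cartesianProductWith⁺ _∷_ (v∈ zero) (∈-vectors⁺ (v∈ ∘ suc))

∈-vectors⁻ : ∀ {A : Set} n (xs : List A) {v} → v ∈ vectors n xs → ∀ i → lookup v i ∈ xs
∈-vectors⁻ (suc n) xs v∈ i with ∈-cartesianProductWith⁻ _∷_ xs (vectors n xs) v∈
∈-vectors⁻ (suc n) xs v∈ zero    | _ , _ , x∈ , _   , refl = x∈
∈-vectors⁻ (suc n) xs v∈ (suc i) | _ , _ , _  , v′∈ , refl = ∈-vectors⁻ n xs v′∈ i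

-- Multiplicity one against unique preimages

count≡0⁺ : ∀ {C : Set} (f : C → ℕ) v cs → (∀ {c} → c ∈ cs → f c ≢ v) → count v (List.map f cs) ≡ 0
count≡0⁺ f v []       _  = refl
count≡0⁺ f v (c ∷ cs) f≢ with f c ℕ.≟ v
... | yes fc≡v = ⊥-elim (f≢ (here refl) fc≡v)
... | no  _    = count≡0⁺ f v cs (f≢ ∘ there)

count≡0⁻ : ∀ {C : Set} (f : C → ℕ) v cs → count v (List.map f cs) ≡ 0 → ∀ {c} → c ∈ cs → f c ≢ v
count≡0⁻ f v (c ∷ cs) eq c∈ fc≡v with f c ℕ.≟ v | c∈
... | no fc≢v | here refl = fc≢v fc≡v
... | no _    | there c∈  = count≡0⁻ f v cs eq c∈ fc≡v

count≡1⇒∃ : ∀ {C : Set} (f : C → ℕ) v cs → count v (List.map f cs) ≡ 1 → ∃ λ c → f c ≡ v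
count≡1⇒∃ f v (c ∷ cs) eq with f c ℕ.≟ v
... | yes fc≡v = c , fc≡v
... | no  _    = count≡1⇒∃ f v cs eq

count≡1⇒unique : ∀ {C : Set} (f : C → ℕ) v cs → count v (List.map f cs) ≡ 1 →
  ∀ {c c′} → c ∈ cs → c′ ∈ cs → f c ≡ v → f c′ ≡ v → c ≡ c′
count≡1⇒unique f v (x ∷ cs) eq c∈ c′∈ fc≡v fc′≡v with f x ℕ.≟ v | c∈ | c′∈
... | yes _   | here refl | here refl = refl
... | yes _   | here refl | there c′∈ = ⊥-elim (count≡0⁻ f v cs (ℕₚ.suc-injective eq) c′∈ fc′≡v)
... | yes _   | there c∈  | _         = ⊥-elim (count≡0⁻ f v cs (ℕₚ.suc-injective eq) c∈ fc≡v)
... | no fx≢v | here refl | _         = ⊥-elim (fx≢v fc≡v)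
... | no fx≢v | there _   | here refl = ⊥-elim (fx≢v fc′≡v)
... | no _    | there c∈  | there c′∈ = count≡1⇒unique f v cs eq c∈ c′∈ fc≡v fc′≡v

∃!⇒count≡1 : ∀ {C : Set} (f : C → ℕ) v {cs} → Unique cs → ∀ {c} → c ∈ cs → f c ≡ v →
  (∀ {c′} → f c′ ≡ v → c ≡ c′) → count v (List.map f cs) ≡ 1
∃!⇒count≡1 f v {x ∷ cs} (x∉ ∷ u) c∈ fc≡v unique with f x ℕ.≟ v | c∈
... | yes fx≡v | _ = cong suc (count≡0⁺ f v cs λ y∈ fy≡v → ListAll.lookup x∉ y∈ (trans (sym (unique fx≡v)) (unique fy≡v)))
... | no fx≢v  | here refl = ⊥-elim (fx≢v fc≡v)
... | no _     | there c∈  = ∃!⇒count≡1 f v u c∈ fc≡v unique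

map-tabulate-lookup : ∀ {k} {P : Set} (h : P → ℕ) (p : Fin k → P) (e : Vec ℕ k) →
  (∀ i → h (p i) ≡ lookup e i) → List.map h (tabulate p) ≡ toList e
map-tabulate-lookup h p []      _  = refl
map-tabulate-lookup h p (_ ∷ e) eq = cong₂ _∷_ (eq zero) (map-tabulate-lookup h (p ∘ suc) e (eq ∘ suc))

Off : ℕ → Set
Off n = Σ (Fin n) λ i → Σ (Fin n) λ j → i Fin.< j

off-≡ : ∀ {n} {i i′ j j′ : Fin n} {i<j : i Fin.< j} {i′<j′ : i′ Fin.< j′} → i ≡ i′ → j ≡ j′ → (i , j , i<j) ≡ (i′ , j′ , i′<j′)
off-≡ {i = i} {j = j} refl refl = cong (λ i<j → i , j , i<j) (ℕₚ.<-irrelevant _ _)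

-- A way to peel the off-diagonal cells of a staircase of size n + 1 into a line of n cells
-- and the off-diagonal cells of a staircase of size n.
record Layout : Set where
  field
    encode        : ∀ {n} → Fin n ⊎ Off n → Off (suc n)
    decode        : ∀ {n} → Off (suc n) → Fin n ⊎ Off n
    encode-decode : ∀ {n} (c : Off (suc n)) → encode (decode c) ≡ c
    decode-encode : ∀ {n} (s : Fin n ⊎ Off n) → decode (encode s) ≡ s

  encode-injective : ∀ {n} {s t : Fin n ⊎ Off n} → encode s ≡ encode t → s ≡ t
  encode-injective {s = s} {t} eq = trans (sym (decode-encode s)) (trans (cong decode eq) (decode-encode t))

module Filling (𝓛 : Layout) where
  open Layout 𝓛

  entry : ∀ {n} → Triangle n → Off n → ℕ
  entry {suc n} (y , T) c = [ lookup y , entry T ]′ (decode c)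

  build : ∀ {n} → (Off n → ℕ) → Triangle n
  build {zero}  h = tt
  build {suc n} h = Vec.tabulate (h ∘ encode ∘ inj₁) , build (h ∘ encode ∘ inj₂)

  entry-build : ∀ {n} (h : Off n → ℕ) → entry (build h) ≗ h
  entry-build {suc n} h c with decode c in eq
  ... | inj₁ i  = trans (Vecₚ.lookup∘tabulate _ i) (cong h (trans (cong encode (sym eq)) (encode-decode c)))
  ... | inj₂ c′ = trans (entry-build _ c′) (cong h (trans (cong encode (sym eq)) (encode-decode c)))

  build-cong : ∀ {n} {h h′ : Off n → ℕ} → h ≗ h′ → build h ≡ build h′
  build-cong {zero}  _    = refl
  build-cong {suc n} h≗h′ = cong₂ _,_ (Vecₚ.tabulate-cong (h≗h′ ∘ encode ∘ inj₁)) (build-cong (h≗h′ ∘ encode ∘ inj₂))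

  entry-line : ∀ {n} y (T : Triangle n) i → entry (y , T) (encode (inj₁ i)) ≡ lookup y i
  entry-line y T i = cong [ lookup y , entry T ]′ (decode-encode (inj₁ i))

  entry-rest : ∀ {n} y (T : Triangle n) c → entry (y , T) (encode (inj₂ c)) ≡ entry T c
  entry-rest y T c = cong [ lookup y , entry T ]′ (decode-encode (inj₂ c))

  build-entry : ∀ {n} (T : Triangle n) → build (entry T) ≡ T
  build-entry {zero}  tt      = refl
  build-entry {suc n} (y , T) = cong₂ _,_
    (trans (Vecₚ.tabulate-cong (entry-line y T)) (Vecₚ.tabulate∘lookup y))
    (trans (build-cong (entry-rest y T)) (build-entry T))

  -- The cells in the order in which `entries` reads a triangle under the given layout.
  offs : ∀ n → List (Off n)
  offs zero    = []
  offs (suc n) = List.map (encode ∘ inj₁) (allFin n) ++ List.map (encode ∘ inj₂) (offs n)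

  ∈-offs : ∀ {n} (c : Off n) → c ∈ offs n
  ∈-offs {suc n} c with decode c | encode-decode c
  ... | inj₁ i  | refl = ∈-++⁺ˡ (∈-map⁺ _ (∈-allFin i))
  ... | inj₂ c′ | refl = ∈-++⁺ʳ _ (∈-map⁺ _ (∈-offs c′))

  offs-unique : ∀ n → Unique (offs n)
  offs-unique zero    = []
  offs-unique (suc n) = Uniqueₚ.++⁺
    (Uniqueₚ.map⁺ (inj₁-injective ∘ encode-injective) (Uniqueₚ.allFin⁺ n))
    (Uniqueₚ.map⁺ (inj₂-injective ∘ encode-injective) (offs-unique n))
    λ (c∈₁ , c∈₂) → case (∈-map⁻ _ c∈₁ , ∈-map⁻ _ c∈₂) of λ { ((_ , _ , eq₁) , (_ , _ , eq₂)) →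
      case encode-injective (trans (sym eq₁) eq₂) of λ () }

  entries≡map : ∀ {n} (T : Triangle n) → List.map (entry T) (offs n) ≡ entries T
  entries≡map {zero}  tt      = refl
  entries≡map {suc n} (y , T) = begin
    List.map (entry (y , T)) (offs (suc n))
      ≡⟨ Listₚ.map-++ (entry (y , T)) (List.map (encode ∘ inj₁) (allFin n)) _ ⟩
    List.map (entry (y , T)) (List.map (encode ∘ inj₁) (allFin n)) ++ List.map (entry (y , T)) (List.map (encode ∘ inj₂) (offs n))
      ≡⟨ cong₂ _++_ (Listₚ.map-∘ (allFin n)) (Listₚ.map-∘ (offs n)) ⟨
    List.map (entry (y , T) ∘ encode ∘ inj₁) (allFin n) ++ List.map (entry (y , T) ∘ encode ∘ inj₂) (offs n)
      ≡⟨ cong₂ _++_ (map-tabulate-lookup _ id y (entry-line y T))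
                    (trans (Listₚ.map-cong (entry-rest y T) (offs n)) (entries≡map T)) ⟩
    toList y ++ entries T ∎
    where open ≡-Reasoning

-- Books as data

-- Fillings as functions agree only pointwise. This first-order form has a usable propositional
-- equality, so books can be listed without repetition and counted by length.
BookData : ℕ → ℕ → Set
BookData n m = Vec ℕ n × Vec (Triangle n) m

pageEntries : ∀ {n m} → Vec (Triangle n) m → List ℕ
pageEntries []       = []
pageEntries (T ∷ Ts) = entries T ++ pageEntries Ts

bookEntries : ∀ {n m} → BookData n m → List ℕ
bookEntries (e , Ts) = toList e ++ pageEntries Ts

off′ : ∀ {n m} → Fin m × Off n → Cell n m
off′ (p , i , j , i<j) = off p i j i<j

-- Fillings are recognised by the coefficient itself, which makes the length of the filtered list a
-- coefficient of a generating function.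
isFilling? : ∀ {n m} (b : BookData n m) → Dec (topMonomial (numCells n m) (bookEntries b) ≡ pos 1)
isFilling? {n} {m} b = topMonomial (numCells n m) (bookEntries b) ℤ.≟ pos 1

fillings : ∀ {n m} → List (BookData n m) → List (BookData n m)
fillings = filter isFilling?

module Book (𝓛 : Layout) where
  open Filling 𝓛 public

  content : ∀ {n m} → BookData n m → Cell n m → ℕ
  content (e , Ts) (diag i)        = lookup e i
  content (e , Ts) (off p i j i<j) = entry (lookup Ts p) (i , j , i<j)

  toData : ∀ {n m} → (Cell n m → ℕ) → BookData n m
  toData f = Vec.tabulate (f ∘ diag) , Vec.tabulate (λ p → build (λ c → f (off′ (p , c))))

  content-toData : ∀ {n m} (f : Cell n m → ℕ) → content (toData f) ≗ f
  content-toData f (diag i)        = Vecₚ.lookup∘tabulate _ i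
  content-toData f (off p i j i<j) = trans
    (cong (λ T → entry T (i , j , i<j)) (Vecₚ.lookup∘tabulate _ p)) (entry-build _ (i , j , i<j))

  toData-cong : ∀ {n m} {f g : Cell n m → ℕ} → f ≗ g → toData f ≡ toData g
  toData-cong f≗g = cong₂ _,_ (Vecₚ.tabulate-cong (f≗g ∘ diag)) (Vecₚ.tabulate-cong (λ p → build-cong (λ c → f≗g (off′ (p , c)))))

  toData-content : ∀ {n m} (b : BookData n m) → toData (content b) ≡ b
  toData-content (e , Ts) = cong₂ _,_ (Vecₚ.tabulate∘lookup e)
    (trans (Vecₚ.tabulate-cong (λ p → build-entry (lookup Ts p))) (Vecₚ.tabulate∘lookup Ts))

  cells : ∀ n m → List (Cell n m)
  cells n m = tabulate diag ++ List.map off′ (cartesianProduct (allFin m) (offs n))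

  ∈-cells : ∀ {n m} (c : Cell n m) → c ∈ cells n m
  ∈-cells (diag i)        = ∈-++⁺ˡ (∈-tabulate⁺ i)
  ∈-cells (off p i j i<j) = ∈-++⁺ʳ _ (∈-map⁺ off′ (∈-cartesianProduct⁺ (∈-allFin p) (∈-offs (i , j , i<j))))

  cells-unique : ∀ n m → Unique (cells n m)
  cells-unique n m = Uniqueₚ.++⁺
    (Uniqueₚ.tabulate⁺ (λ { refl → refl }))
    (Uniqueₚ.map⁺ (λ { refl → refl }) (Uniqueₚ.cartesianProduct⁺ (Uniqueₚ.allFin⁺ m) (offs-unique n)))
    λ (c∈₁ , c∈₂) → case (∈-tabulate⁻ c∈₁ , ∈-map⁻ off′ c∈₂) of λ { ((_ , refl) , (_ , _ , ())) }

  pageEntries≡map : ∀ {n m k} (h : Fin m × Off n → ℕ) (p : Fin k → Fin m) (Ts : Vec (Triangle n) k) →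
    (∀ i c → h (p i , c) ≡ entry (lookup Ts i) c) →
    List.map h (cartesianProduct (tabulate p) (offs n)) ≡ pageEntries Ts
  pageEntries≡map h p []       _  = refl
  pageEntries≡map {n} h p (T ∷ Ts) eq = begin
    List.map h (List.map (p zero ,_) (offs n) ++ cartesianProduct (tabulate (p ∘ suc)) (offs n))
      ≡⟨ Listₚ.map-++ h (List.map (p zero ,_) (offs n)) _ ⟩
    List.map h (List.map (p zero ,_) (offs n)) ++ List.map h (cartesianProduct (tabulate (p ∘ suc)) (offs n))
      ≡⟨ cong₂ _++_ (trans (sym (Listₚ.map-∘ (offs n))) (trans (Listₚ.map-cong (eq zero) (offs n)) (entries≡map T)))
                    (pageEntries≡map h (p ∘ suc) Ts (eq ∘ suc)) ⟩
    entries T ++ pageEntries Ts ∎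
    where open ≡-Reasoning

  bookEntries≡map : ∀ {n m} (b : BookData n m) → List.map (content b) (cells n m) ≡ bookEntries b
  bookEntries≡map {n} {m} b@(e , Ts) = trans
    (Listₚ.map-++ (content b) (tabulate diag) _)
    (cong₂ _++_ (map-tabulate-lookup (content b) diag e (λ _ → refl))
                (trans (sym (Listₚ.map-∘ (cartesianProduct (allFin m) (offs n)))) (pageEntries≡map _ id Ts (λ _ _ → refl))))

  EachOnce⇒IsFilling : ∀ {n m} (b : BookData n m) → EachOnce (numCells n m) (bookEntries b) → IsFilling n m (content b)
  EachOnce⇒IsFilling {n} {m} b each = record
    { inRange  = λ c → bounded (subst (content b c ∈_) (bookEntries≡map b) (∈-map⁺ (content b) (∈-cells c)))
    ; usedOnce = λ v 1≤v v≤N →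
        let once′ = trans (cong (count v) (bookEntries≡map b)) (once v 1≤v v≤N)
            c , fc≡v = count≡1⇒∃ (content b) v (cells n m) once′
        in c , fc≡v , λ fc′≡v → count≡1⇒unique (content b) v (cells n m) once′ (∈-cells c) (∈-cells _) fc≡v fc′≡v
    }
    where open EachOnce each

  IsFilling⇒EachOnce : ∀ {n m} (b : BookData n m) → IsFilling n m (content b) → EachOnce (numCells n m) (bookEntries b)
  IsFilling⇒EachOnce {n} {m} b filling = record
    { bounded = λ v∈ → case ∈-map⁻ (content b) (subst (_ ∈_) (sym (bookEntries≡map b)) v∈) of λ { (c , _ , refl) → inRange c }
    ; once    = λ v 1≤v v≤N →
        let c , fc≡v , unique = usedOnce v 1≤v v≤N
        in trans (cong (count v) (sym (bookEntries≡map b))) (∃!⇒count≡1 (content b) v (cells-unique n m) (∈-cells c) fc≡v unique)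
    }
    where open IsFilling filling

  IsFilling-resp : ∀ {n m} {f g : Cell n m → ℕ} → f ≗ g → IsFilling n m f → IsFilling n m g
  IsFilling-resp f≗g filling = record
    { inRange  = λ c → subst (λ v → 1 ≤ v × v ≤ _) (f≗g c) (inRange c)
    ; usedOnce = λ v 1≤v v≤N →
        let c , fc≡v , unique = usedOnce v 1≤v v≤N
        in c , trans (sym (f≗g c)) fc≡v , λ {c′} gc′≡v → unique (trans (f≗g c′) gc′≡v)
    }
    where open IsFilling filling

  -- Soundness is asked of fillings only. The list of candidates may therefore be cut out by weak
  -- inequalities that imply `P` only when the entries are distinct.
  hasCard : ∀ {n m} (P : (Cell n m → ℕ) → Set) (bs : List (BookData n m)) → Unique bs →
    (∀ {f} → P f → IsFilling n m f × toData f ∈ bs) →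
    (∀ {b} → b ∈ bs → IsFilling n m (content b) → P (content b)) →
    HasCard (Books n m P) (length (fillings bs))
  hasCard {n} {m} P bs unique complete sound = record
    { to        = λ i → content (at i) , at-P i
    ; from      = λ (f , Pf) → Any.index (toData∈ Pf)
    ; to-cong   = λ { refl _ → refl }
    ; from-cong = λ {(f , Pf)} {(g , Pg)} f≗g → at-injective _ _
        (trans (sym (lookup-index (toData∈ Pf))) (trans (toData-cong f≗g) (lookup-index (toData∈ Pg))))
    ; inverse   = (λ { {f , Pf} refl c → trans (cong (λ b → content b c) (sym (lookup-index (toData∈ Pf)))) (content-toData f c) })
                , (λ { {i} {f , Pf} f≗ → at-injective _ _
                     (trans (sym (lookup-index (toData∈ Pf))) (trans (toData-cong f≗) (toData-content (at i)))) })
    }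
    where
    at : Fin (length (fillings bs)) → BookData n m
    at = List.lookup (fillings bs)

    at-injective : ∀ i j → at i ≡ at j → i ≡ j
    at-injective = lookup-injective (Uniqueₚ.filter⁺ isFilling? unique)

    at-P : ∀ i → P (content (at i))
    at-P i with ∈-filter⁻ isFilling? {xs = bs} (∈-lookup i)
    ... | b∈ , top≡1 = sound b∈ (EachOnce⇒IsFilling (at i) (topMonomial≡1⇒EachOnce _ _ top≡1))

    toData∈ : ∀ {f} → P f → toData f ∈ fillings bs
    toData∈ {f} Pf with complete Pf
    ... | filling , f∈ = ∈-filter⁺ isFilling? f∈ (EachOnce⇒topMonomial≡1 _ _
      (IsFilling⇒EachOnce (toData f) (IsFilling-resp (λ c → sym (content-toData f c)) filling)))

-- Selberg and Young pages

-- Peels off the top row; the rest is a page on the remaining diagonal cells.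
rows-first : Layout
rows-first = record
  { encode        = encode
  ; decode        = decode
  ; encode-decode = λ { (zero , suc j , s≤s z≤n) → refl ; (suc i , suc j , s≤s i<j) → refl }
  ; decode-encode = λ { (inj₁ j) → refl ; (inj₂ c) → refl }
  }
  where
  encode : ∀ {n} → Fin n ⊎ Off n → Off (suc n)
  encode (inj₁ j)             = zero , suc j , s≤s z≤n
  encode (inj₂ (i , j , i<j)) = suc i , suc j , s≤s i<j

  decode : ∀ {n} → Off (suc n) → Fin n ⊎ Off n
  decode (zero  , suc j , _)       = inj₁ j
  decode (suc i , suc j , s≤s i<j) = inj₂ (i , j , i<j)

lower-row : ∀ {n} (i : Fin (suc n)) (j : Fin n) → i Fin.< suc j → Σ (Fin n) λ i′ → inject₁ i′ ≡ i
lower-row zero    zero    _         = zero , refl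
lower-row zero    (suc j) _         = zero , refl
lower-row (suc i) zero    (s≤s ())
lower-row (suc i) (suc j) (s≤s i<j) = let i′ , eq = lower-row i j i<j in suc i′ , cong suc eq

inject₁-<-suc : ∀ {n} {i j : Fin n} → i Fin.≤ j → inject₁ i Fin.< Fin.suc j
inject₁-<-suc {i = i} {j} i≤j = s≤s (subst (_≤ toℕ j) (sym (Finₚ.toℕ-inject₁ i)) i≤j)

inject₁-<-suc⁻ : ∀ {n} {i j : Fin n} → inject₁ i Fin.< Fin.suc j → i Fin.≤ j
inject₁-<-suc⁻ {i = i} {j} (s≤s i≤j) = subst (_≤ toℕ j) (Finₚ.toℕ-inject₁ i) i≤j

-- Peels off the cells (i, i + 1), which become the diagonal of the smaller page; its cell (i, j) is
-- the cell (i, j + 1) of the larger one.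
diagonals-first : Layout
diagonals-first = record
  { encode        = encode
  ; decode        = decode
  ; encode-decode = encode-decode
  ; decode-encode = decode-encode
  }
  where
  encode : ∀ {n} → Fin n ⊎ Off n → Off (suc n)
  encode (inj₁ i)             = inject₁ i , suc i , inject₁-<-suc ℕₚ.≤-refl
  encode (inj₂ (i , j , i<j)) = inject₁ i , suc j , inject₁-<-suc (ℕₚ.<⇒≤ i<j)

  split : ∀ {n} (i j : Fin n) → i Fin.≤ j → Fin n ⊎ Off n
  split i j i≤j with i Finₚ.≟ j
  ... | yes _  = inj₁ i
  ... | no i≢j = inj₂ (i , j , Finₚ.≤∧≢⇒< i≤j i≢j)

  decode : ∀ {n} → Off (suc n) → Fin n ⊎ Off n
  decode (i , suc j , i<j) with lower-row i j i<j
  ... | i′ , refl = split i′ j (inject₁-<-suc⁻ i<j)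

  encode-decode : ∀ {n} (c : Off (suc n)) → encode (decode c) ≡ c
  encode-decode (i , suc j , i<j) with lower-row i j i<j
  ... | i′ , refl with i′ Finₚ.≟ j
  ... | yes refl = off-≡ refl refl
  ... | no _     = off-≡ refl refl

  split-≡ : ∀ {n} (i : Fin n) i≤i → split i i i≤i ≡ inj₁ i
  split-≡ i _ with i Finₚ.≟ i
  ... | yes _  = refl
  ... | no i≢i = ⊥-elim (i≢i refl)

  split-< : ∀ {n} (i j : Fin n) i≤j i<j → split i j i≤j ≡ inj₂ (i , j , i<j)
  split-< i j _ i<j with i Finₚ.≟ j
  ... | yes refl = ⊥-elim (ℕₚ.<-irrefl refl i<j)
  ... | no _     = cong inj₂ (off-≡ refl refl)

  decode-encode : ∀ {n} (s : Fin n ⊎ Off n) → decode (encode s) ≡ s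
  decode-encode (inj₁ i) with lower-row (inject₁ i) i (inject₁-<-suc ℕₚ.≤-refl)
  -- The row recovered by `lower-row` is identified with `i` by injectivity.
  ... | i′ , eq with Finₚ.inject₁-injective eq
  decode-encode (inj₁ i) | i′ , refl | refl = split-≡ i _
  decode-encode (inj₂ (i , j , i<j)) with lower-row (inject₁ i) j (inject₁-<-suc (ℕₚ.<⇒≤ i<j))
  ... | i′ , eq with Finₚ.inject₁-injective eq
  decode-encode (inj₂ (i , j , i<j)) | i′ , refl | refl = split-< i j _ i<j

Between : ∀ {n} → (Fin n → ℕ) → (Off n → ℕ) → Set
Between g h = ∀ i j i<j → g i ≤ h (i , j , i<j) × h (i , j , i<j) < g j

-- The lower bounds and the rows are only weakly monotone: the half-open ranges telescope, and
-- strictness comes back from the distinctness of the entries of a filling.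
record SemistandardPage {n} (g : Fin n → ℕ) (h : Off n → ℕ) : Set where
  field
    between : Between g h
    rows    : ∀ i j k i<j i<k → j Fin.< k → h (i , j , i<j) ≤ h (i , k , i<k)
    columns : ∀ i k j i<j k<j → i Fin.< k → h (i , j , i<j) < h (k , j , k<j)

-- All that separates the two kinds of books: the shape of one page, its cell order and its
-- enumeration.
record PageKind : Set₁ where
  field
    layout           : Layout
    Valid            : ∀ {n} → (Fin n → ℕ) → (Off n → ℕ) → Set
    valid-resp       : ∀ {n} {g g′ : Fin n → ℕ} {h h′} → g ≗ g′ → h ≗ h′ → Valid g h → Valid g′ h′
    triangles        : ∀ {n} → Vec ℕ n → List (Triangle n)
    triangles-unique : ∀ {n} (e : Vec ℕ n) → Unique (triangles e)
    ∈-triangles⁺     : ∀ {n} (e : Vec ℕ n) T → Valid (lookup e) (Filling.entry layout T) → T ∈ triangles e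
    ∈-triangles⁻     : ∀ {n} (e : Vec ℕ n) T → T ∈ triangles e → Valid (lookup e) (Filling.entry layout T)

between-resp : ∀ {n} {g g′ : Fin n → ℕ} {h h′} → g ≗ g′ → h ≗ h′ → Between g h → Between g′ h′
between-resp g≗ h≗ b i j i<j =
  subst₂ _≤_ (g≗ i) (h≗ _) (proj₁ (b i j i<j)) , subst₂ _<_ (h≗ _) (g≗ j) (proj₂ (b i j i<j))

selbergPages : PageKind
selbergPages = record
  { layout           = rows-first
  ; Valid            = Between
  ; valid-resp       = between-resp
  ; triangles        = selbergTriangles
  ; triangles-unique = selbergTriangles-unique
  ; ∈-triangles⁺     = ∈⁺
  ; ∈-triangles⁻     = ∈⁻
  }
  where
  open Filling rows-first
  ∈⁺ : ∀ {n} (e : Vec ℕ n) T → Between (lookup e) (entry T) → T ∈ selbergTriangles e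
  ∈⁺ []      tt      _ = here refl
  ∈⁺ (a ∷ e) (y , T) b = ∈-cartesianProduct⁺
    (∈-box⁺ a e (λ j → b zero (suc j) (s≤s z≤n))) (∈⁺ e T (λ i j i<j → b (suc i) (suc j) (s≤s i<j)))

  ∈⁻ : ∀ {n} (e : Vec ℕ n) T → T ∈ selbergTriangles e → Between (lookup e) (entry T)
  ∈⁻ (a ∷ e) (y , T) T∈ zero    (suc j) _         = ∈-box⁻ a e (proj₁ (∈-cartesianProduct⁻ (box a e) (selbergTriangles e) T∈)) j
  ∈⁻ (a ∷ e) (y , T) T∈ (suc i) (suc j) (s≤s i<j) = ∈⁻ e T (proj₂ (∈-cartesianProduct⁻ (box a e) (selbergTriangles e) T∈)) i j i<j

open Layout diagonals-first using (encode; decode; encode-decode)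

Interlaced : ∀ {n} → (Fin (suc n) → ℕ) → (Fin n → ℕ) → Set
Interlaced g y = ∀ i → g (inject₁ i) ≤ y i × y i < g (suc i)

-- The bounds of the smaller page are monotonicity in the larger one: along row i from (i, i + 1) to
-- (i, j + 1), weakly, and down column j + 1 to (j, j + 1), strictly.
semistandard-peel : ∀ {n} {g : Fin (suc n) → ℕ} {h} → SemistandardPage g h →
  Interlaced g (h ∘ encode ∘ inj₁) × SemistandardPage (h ∘ encode ∘ inj₁) (h ∘ encode ∘ inj₂)
semistandard-peel {n} {g} {h} page = (λ i → between _ _ _) , record
  { between = λ i j i<j → rows _ _ _ _ _ (s≤s i<j) , columns _ _ _ _ _ (inject₁-mono i<j)
  ; rows    = λ i j k _ _ j<k → rows _ _ _ _ _ (s≤s j<k)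
  ; columns = λ i k j _ _ i<k → columns _ _ _ _ _ (inject₁-mono i<k)
  }
  where
  open SemistandardPage page
  inject₁-mono : {i j : Fin n} → i Fin.< j → inject₁ i Fin.< inject₁ j
  inject₁-mono {i} {j} = subst₂ _<_ (sym (Finₚ.toℕ-inject₁ i)) (sym (Finₚ.toℕ-inject₁ j))

-- Bounds by the outer diagonal follow by chaining through the peeled line. Comparisons that involve
-- a cell of that line are the bounds of the inner page; all others are its monotonicity.
semistandard-unpeel : ∀ {n} {g : Fin (suc n) → ℕ} {h} → Interlaced g (h ∘ encode ∘ inj₁) →
  SemistandardPage (h ∘ encode ∘ inj₁) (h ∘ encode ∘ inj₂) → SemistandardPage g h
semistandard-unpeel {n} {g} {h} interlaced page = record
  { between = λ i j i<j → between′ (i , j , i<j)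
  ; rows    = λ i j k i<j i<k → rows′ (i , j , i<j) k i<k
  ; columns = λ i k j i<j k<j → columns′ i (k , j , k<j) i<j
  }
  where
  open SemistandardPage page
  inject₁-mono⁻ : {i j : Fin n} → inject₁ i Fin.< inject₁ j → i Fin.< j
  inject₁-mono⁻ {i} {j} = subst₂ _<_ (Finₚ.toℕ-inject₁ i) (Finₚ.toℕ-inject₁ j)

  inner : ∀ (i j : Fin n) (i<j : i Fin.< j) {p} → h (encode (inj₂ (i , j , i<j))) ≡ h (inject₁ i , suc j , p)
  inner i j i<j = cong h (off-≡ refl refl)

  between′ : ∀ (c : Off (suc n)) → g (proj₁ c) ≤ h c × h c < g (proj₁ (proj₂ c))
  between′ c with decode c | encode-decode c
  ... | inj₁ i             | refl = interlaced i
  ... | inj₂ (i , j , i<j) | refl =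
    ℕₚ.≤-trans (proj₁ (interlaced i)) (proj₁ (between i j i<j)) ,
    ℕₚ.<-trans (proj₂ (between i j i<j)) (proj₂ (interlaced j))

  rows′ : ∀ (c : Off (suc n)) k i<k → proj₁ (proj₂ c) Fin.< k → h c ≤ h (proj₁ c , k , i<k)
  rows′ c (suc k) i<k j<k with decode c | encode-decode c
  rows′ c (suc k) i<k (s≤s i<k′) | inj₁ i             | refl =
    subst (h (encode (inj₁ i)) ≤_) (inner i k i<k′) (proj₁ (between i k i<k′))
  rows′ c (suc k) i<k (s≤s j<k′) | inj₂ (i , j , i<j) | refl =
    subst (h (encode (inj₂ (i , j , i<j))) ≤_) (inner i k (ℕₚ.<-trans i<j j<k′)) (rows i j k i<j (ℕₚ.<-trans i<j j<k′) j<k′)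

  columns′ : ∀ i (c : Off (suc n)) i<j → i Fin.< proj₁ c → h (i , proj₁ (proj₂ c) , i<j) < h c
  columns′ i c@(_ , suc _ , _) i<j i<k with decode c | encode-decode c | lower-row i _ i<j
  ... | inj₁ k             | refl | i′ , refl =
    subst (_< h (encode (inj₁ k))) (inner i′ k (inject₁-mono⁻ i<k)) (proj₂ (between i′ k (inject₁-mono⁻ i<k)))
  ... | inj₂ (k , j , k<j) | refl | i′ , refl =
    subst (_< h (encode (inj₂ (k , j , k<j)))) (inner i′ j (ℕₚ.<-trans (inject₁-mono⁻ i<k) k<j))
      (columns i′ k j (ℕₚ.<-trans (inject₁-mono⁻ i<k) k<j) k<j (inject₁-mono⁻ i<k))

semistandard-resp : ∀ {n} {g g′ : Fin n → ℕ} {h h′} → g ≗ g′ → h ≗ h′ → SemistandardPage g h → SemistandardPage g′ h′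
semistandard-resp g≗ h≗ page = record
  { between = between-resp g≗ h≗ between
  ; rows    = λ i j k i<j i<k j<k → subst₂ _≤_ (h≗ _) (h≗ _) (rows i j k i<j i<k j<k)
  ; columns = λ i k j i<j k<j i<k → subst₂ _<_ (h≗ _) (h≗ _) (columns i k j i<j k<j i<k)
  }
  where open SemistandardPage page

youngPages : PageKind
youngPages = record
  { layout           = diagonals-first
  ; Valid            = SemistandardPage
  ; valid-resp       = semistandard-resp
  ; triangles        = youngTriangles
  ; triangles-unique = youngTriangles-unique
  ; ∈-triangles⁺     = ∈⁺
  ; ∈-triangles⁻     = ∈⁻
  }
  where
  open Filling diagonals-first
  ∈⁺ : ∀ {n} (e : Vec ℕ n) T → SemistandardPage (lookup e) (entry T) → T ∈ youngTriangles e
  ∈⁺ []      tt      _    = here refl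
  ∈⁺ (a ∷ e) (y , T) page with semistandard-peel page
  ... | interlaced , page′ = ∈-pairs⁺
    (∈-interlacing⁺ a e (λ i → subst (λ v → lookup (a ∷ e) (inject₁ i) ≤ v × v < lookup e i) (entry-line y T i) (interlaced i)))
    (∈⁺ y T (semistandard-resp (entry-line y T) (entry-rest y T) page′))

  ∈⁻ : ∀ {n} (e : Vec ℕ n) T → T ∈ youngTriangles e → SemistandardPage (lookup e) (entry T)
  ∈⁻ []      tt      _  = record { between = λ () ; rows = λ () ; columns = λ () }
  ∈⁻ (a ∷ e) (y , T) T∈ with ∈-pairs⁻ (interlacing a e) T∈
  ... | y∈ , T′∈ = semistandard-unpeel
    (λ i → subst (λ v → lookup (a ∷ e) (inject₁ i) ≤ v × v < lookup e i) (sym (entry-line y T i)) (∈-interlacing⁻ a e y∈ i))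
    (semistandard-resp (sym ∘ entry-line y T) (sym ∘ entry-rest y T) (∈⁻ y T T′∈))

-- Counting books

sorted⁺ : ∀ {n} (e : Vec ℕ n) → (∀ i j → i Fin.< j → lookup e i ≤ lookup e j) → Sorted e
sorted⁺ []      _    = []
sorted⁺ (a ∷ e) mono = subst (All (a ≤_)) (Vecₚ.tabulate∘lookup e) (Allₚ.tabulate⁺ (λ j → mono zero (suc j) (s≤s z≤n)))
                     ∷ sorted⁺ e (λ i j i<j → mono (suc i) (suc j) (s≤s i<j))

-- Covers both claims at once: prescribed gaps, or no condition. It sees the diagonal only, so it
-- filters the outer sum and leaves the page sums alone.
record DiagonalCondition (n : ℕ) : Set₁ where
  field
    Holds      : (Fin n → ℕ) → Set
    holds?     : ∀ g → Dec (Holds g)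
    holds-resp : ∀ {g g′} → g ≗ g′ → Holds g → Holds g′

module Enumeration {n : ℕ} (m : ℕ) (D : DiagonalCondition n) where
  open DiagonalCondition D

  N : ℕ
  N = numCells n m

  admissible? : ∀ (e : Vec ℕ n) → Dec (Sorted e × Holds (lookup e))
  admissible? e = allPairs? ℕₚ._≤?_ e ×-dec holds? (lookup e)

  -- The half-open range ends at `suc N` to include N. Weak order is enough for telescoping;
  -- repeated diagonal entries are discarded later with all other non-fillings.
  diagonals : List (Vec ℕ n)
  diagonals = filter admissible? (vectors n (range 1 (suc N)))

  diagonals-sorted : ∀ {e} → e ∈ diagonals → Sorted e
  diagonals-sorted e∈ = proj₁ (proj₂ (∈-filter⁻ admissible? {xs = vectors n (range 1 (suc N))} e∈))

  books : (Vec ℕ n → List (Triangle n)) → List (BookData n m)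
  books triangles = pairs diagonals (λ e → vectors m (triangles e))

  module _ (K : PageKind) where
    open PageKind K
    open Book layout

    hasCard-books : (P : (Cell n m → ℕ) → Set) →
      (∀ {f} → P f → IsFilling n m f) →
      (∀ {f} → P f → ∀ i j → i Fin.< j → f (diag i) ≤ f (diag j)) →
      (∀ {f} → P f → Holds (f ∘ diag)) →
      (∀ {f} → P f → ∀ p → Valid (f ∘ diag) (λ c → f (off′ (p , c)))) →
      (∀ {f} → IsFilling n m f → Holds (f ∘ diag) → (∀ p → Valid (f ∘ diag) (λ c → f (off′ (p , c)))) → P f) →
      HasCard (Books n m P) (length (fillings (books triangles)))
    hasCard-books P filling monotone holds valid P⁺ = hasCard P (books triangles)
      (pairs-unique (Uniqueₚ.filter⁺ admissible? (vectors-unique n (range-unique 1 (suc N)))) (λ e → vectors-unique m (triangles-unique e)))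
      (λ Pf → filling Pf , toData∈ Pf)
      sound
      where
      toData∈ : ∀ {f} → P f → toData f ∈ books triangles
      toData∈ {f} Pf = ∈-pairs⁺
        (∈-filter⁺ admissible?
          (∈-vectors⁺ (λ i → let 1≤ , ≤N = subst (λ v → 1 ≤ v × v ≤ N) (f≗ (diag i)) (IsFilling.inRange (filling Pf) (diag i)) in ∈-range⁺ 1≤ (s≤s ≤N)))
          ( sorted⁺ _ (λ i j i<j → subst₂ _≤_ (f≗ (diag i)) (f≗ (diag j)) (monotone Pf i j i<j))
          , holds-resp (f≗ ∘ diag) (holds Pf)))
        (∈-vectors⁺ (λ p → ∈-triangles⁺ _ _ (valid-resp (f≗ ∘ diag) (λ c → f≗ (off′ (p , c))) (valid Pf p))))
        where
        f≗ : f ≗ content (toData f)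
        f≗ c = sym (content-toData f c)

      sound : ∀ {b} → b ∈ books triangles → IsFilling n m (content b) → P (content b)
      sound {e , Ts} b∈ fill with ∈-pairs⁻ diagonals b∈
      ... | e∈ , Ts∈ = P⁺ fill (proj₂ (proj₂ (∈-filter⁻ admissible? {xs = vectors n (range 1 (suc N))} e∈)))
        (λ p → ∈-triangles⁻ e (lookup Ts p) (∈-vectors⁻ m (triangles e) Ts∈ p))

  open SquareFree N
  open Vandermonde (squareFree N) using (powers)
  open Solver (squareFree N) using (solve; con; _:+_; _:*_; _:=_)
  open ≡-Reasoning

  -- Pages on a common diagonal are chosen independently, because distinctness across pages is left
  -- to the monomials.
  vectors-sum : ∀ k (Ts : List (Triangle n)) →
    ∑ (vectors k Ts) (monomial ∘ pageEntries) ≡ powers (∑ Ts (monomial ∘ entries)) k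
  vectors-sum zero    Ts = solve 0 (con (pos 1) :+ con (pos 0) := con (pos 1)) refl
  vectors-sum (suc k) Ts = trans
    (∑-product _∷_ (monomial ∘ pageEntries) (monomial ∘ entries) (monomial ∘ pageEntries)
      (λ T Ts′ → monomial-++ (entries T) (pageEntries Ts′)) Ts (vectors k Ts))
    (cong (∑ Ts (monomial ∘ entries) *_) (vectors-sum k Ts))

  books-sum : ∀ triangles → ∑ (books triangles) (monomial ∘ bookEntries) ≡
    ∑ diagonals (λ e → monomial (toList e) * powers (∑ (triangles e) (monomial ∘ entries)) m)
  books-sum triangles = trans (∑-pairs _ diagonals (λ e → vectors m (triangles e))) (∑-cong diagonals (λ {e} _ → begin
    ∑ (vectors m (triangles e)) (λ Ts → monomial (toList e ++ pageEntries Ts))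
      ≡⟨ ∑-cong (vectors m (triangles e)) (λ {Ts} _ → monomial-++ (toList e) (pageEntries Ts)) ⟩
    ∑ (vectors m (triangles e)) (λ Ts → monomial (toList e) * monomial (pageEntries Ts))
      ≡⟨ *-∑ (monomial (toList e)) (monomial ∘ pageEntries) (vectors m (triangles e)) ⟩
    monomial (toList e) * ∑ (vectors m (triangles e)) (monomial ∘ pageEntries)
      ≡⟨ cong (monomial (toList e) *_) (vectors-sum m (triangles e)) ⟩
    monomial (toList e) * powers (∑ (triangles e) (monomial ∘ entries)) m ∎))

  powers-ι : ∀ c x k → powers (ι (pos c) * x) k ≡ ι (pos (c ℕ.^ k)) * powers x k
  powers-ι c x zero    = solve 0 (con (pos 1) := con (pos 1) :* con (pos 1)) refl
  powers-ι c x (suc k) = begin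
    (ι (pos c) * x) * powers (ι (pos c) * x) k            ≡⟨ cong ((ι (pos c) * x) *_) (powers-ι c x k) ⟩
    (ι (pos c) * x) * (ι (pos (c ℕ.^ k)) * powers x k)    ≡⟨ solve 4 (λ a x b y → (a :* x) :* (b :* y) := (a :* b) :* (x :* y)) refl _ x _ _ ⟩
    (ι (pos c) * ι (pos (c ℕ.^ k))) * (x * powers x k)    ≡⟨ cong (_* (x * powers x k)) (trans (cong ι (ℤₚ.pos-* c (c ℕ.^ k))) (ι-* _ _)) ⟨
    ι (pos (c ℕ.^ suc k)) * (x * powers x k)              ∎

  -- Holds term by term in the diagonal: both page sums are compared with the same Vandermonde
  -- product, and the constant is raised to the number of pages.
  selberg≡young : ∑ (books selbergTriangles) (monomial ∘ bookEntries) ≡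
    ι (pos (superfactorial n ℕ.^ m)) * ∑ (books youngTriangles) (monomial ∘ bookEntries)
  selberg≡young = begin
    ∑ (books selbergTriangles) (monomial ∘ bookEntries)
      ≡⟨ books-sum selbergTriangles ⟩
    ∑ diagonals (λ e → monomial (toList e) * powers (∑ (selbergTriangles e) (monomial ∘ entries)) m)
      ≡⟨ ∑-cong diagonals (λ {e} e∈ → begin
           monomial (toList e) * powers (∑ (selbergTriangles e) (monomial ∘ entries)) m
             ≡⟨ cong (λ s → monomial (toList e) * powers s m) (trans (selberg-sum (diagonals-sorted e∈)) (sym (young-sum (diagonals-sorted e∈)))) ⟩
           monomial (toList e) * powers (ι (pos (superfactorial n)) * Y e) m
             ≡⟨ cong (monomial (toList e) *_) (powers-ι (superfactorial n) (Y e) m) ⟩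
           monomial (toList e) * (ι (pos (superfactorial n ℕ.^ m)) * powers (Y e) m)
             ≡⟨ solve 3 (λ x y z → x :* (y :* z) := y :* (x :* z)) refl _ _ _ ⟩
           ι (pos (superfactorial n ℕ.^ m)) * (monomial (toList e) * powers (Y e) m) ∎) ⟩
    ∑ diagonals (λ e → ι (pos (superfactorial n ℕ.^ m)) * (monomial (toList e) * powers (Y e) m))
      ≡⟨ *-∑ (ι (pos (superfactorial n ℕ.^ m))) _ diagonals ⟩
    ι (pos (superfactorial n ℕ.^ m)) * ∑ diagonals (λ e → monomial (toList e) * powers (Y e) m)
      ≡⟨ cong (ι (pos (superfactorial n ℕ.^ m)) *_) (books-sum youngTriangles) ⟨
    ι (pos (superfactorial n ℕ.^ m)) * ∑ (books youngTriangles) (monomial ∘ bookEntries) ∎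
    where
    Y : Vec ℕ n → Carrier
    Y e = ∑ (youngTriangles e) (monomial ∘ entries)

  length-books : length (fillings (books selbergTriangles)) ≡ superfactorial n ℕ.^ m ℕ.* length (fillings (books youngTriangles))
  length-books = ℤₚ.+-injective (begin
    pos (length (fillings (books selbergTriangles)))
      ≡⟨ length-filter-topMonomial N bookEntries (books selbergTriangles) ⟩
    topCoefficient N (∑ (books selbergTriangles) (monomial ∘ bookEntries))
      ≡⟨ cong (topCoefficient N) selberg≡young ⟩
    topCoefficient N (ι (pos (superfactorial n ℕ.^ m)) * ∑ (books youngTriangles) (monomial ∘ bookEntries))
      ≡⟨ topCoefficient-ι N (pos (superfactorial n ℕ.^ m)) _ ⟩
    pos (superfactorial n ℕ.^ m) ℤ.* topCoefficient N (∑ (books youngTriangles) (monomial ∘ bookEntries))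
      ≡⟨ cong (pos (superfactorial n ℕ.^ m) ℤ.*_) (length-filter-topMonomial N bookEntries (books youngTriangles)) ⟨
    pos (superfactorial n ℕ.^ m) ℤ.* pos (length (fillings (books youngTriangles)))
      ≡⟨ ℤₚ.pos-* (superfactorial n ℕ.^ m) _ ⟨
    pos (superfactorial n ℕ.^ m ℕ.* length (fillings (books youngTriangles))) ∎)

-- Page conditions against the definitions of books

column : ∀ {n m} → Cell n m → Fin n
column (diag j)      = j
column (off _ _ j _) = j

off-page : ∀ {n m} {p : Fin m} {i j : Fin n} (i≤j : i Fin.≤ j) (i<j : i Fin.< j) → page p i j i≤j ≡ off p i j i<j
off-page {p = p} {i} {j} i≤j i<j with i Finₚ.≟ j
... | yes refl = ⊥-elim (ℕₚ.<-irrefl refl i<j)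
... | no _     = cong (off p i j) (ℕₚ.<-irrelevant _ _)

module _ {n m : ℕ} {f : Cell n m → ℕ} where

  filling-injective : IsFilling n m f → ∀ {c c′} → f c ≡ f c′ → c ≡ c′
  filling-injective filling {c} {c′} eq =
    let 1≤fc , fc≤N = inRange c
        _ , _ , unique = usedOnce (f c) 1≤fc fc≤N
    in trans (sym (unique refl)) (unique (sym eq))
    where open IsFilling filling

  ≤⇒< : IsFilling n m f → ∀ {c c′} → c ≢ c′ → f c ≤ f c′ → f c < f c′
  ≤⇒< filling c≢c′ fc≤fc′ = ℕₚ.≤∧≢⇒< fc≤fc′ (c≢c′ ∘ filling-injective filling)

  Selberg⇒Between : IsSelberg n m f → ∀ p → Between (f ∘ diag) (λ c → f (off′ (p , c)))
  Selberg⇒Between selberg p i j i<j = let l , u = IsSelberg.between selberg p i j i<j in ℕₚ.<⇒≤ l , u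

  Between⇒Selberg : IsFilling n m f → (∀ p → Between (f ∘ diag) (λ c → f (off′ (p , c)))) → IsSelberg n m f
  Between⇒Selberg filling b = record
    { isFilling = filling
    ; between   = λ p i j i<j → let l , u = b p i j i<j in ≤⇒< filling (λ ()) l , u
    }

  Young⇒Semistandard : IsYoung n m f → ∀ p → SemistandardPage (f ∘ diag) (λ c → f (off′ (p , c)))
  Young⇒Semistandard young p = record
    { between = Selberg⇒Between isSelberg p
    ; rows    = λ i j k i<j i<k j<k → ℕₚ.<⇒≤ (subst₂ (λ c c′ → f c < f c′)
        (off-page (ℕₚ.<⇒≤ i<j) i<j) (off-page (ℕₚ.<⇒≤ i<k) i<k) (rows p i j k _ _ j<k))
    ; columns = λ i k j i<j k<j i<k → subst₂ (λ c c′ → f c < f c′)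
        (off-page (ℕₚ.<⇒≤ i<j) i<j) (off-page (ℕₚ.<⇒≤ k<j) k<j) (columns p i k j _ _ i<k)
    }
    where open IsYoung young

  -- Rows that start and columns that end on the diagonal are governed by the Selberg bounds; the
  -- other rows become strict because a filling is injective.
  Semistandard⇒Young : IsFilling n m f → (∀ p → SemistandardPage (f ∘ diag) (λ c → f (off′ (p , c)))) → IsYoung n m f
  Semistandard⇒Young filling pages = record
    { isSelberg = selberg
    ; rows      = rows
    ; columns   = columns
    }
    where
    selberg = Between⇒Selberg filling (λ p → SemistandardPage.between (pages p))

    rows : ∀ p i j k i≤j i≤k → j Fin.< k → f (page p i j i≤j) < f (page p i k i≤k)
    rows p i j k i≤j i≤k j<k with i Finₚ.≟ j
    ... | yes refl = subst (λ c → f (diag i) < f c) (sym (off-page i≤k j<k)) (proj₁ (IsSelberg.between selberg p i k j<k))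
    ... | no i≢j   = subst (λ c → f (off p i j i<j) < f c) (sym (off-page i≤k i<k))
      -- The two cells are distinct because their columns are.
      (≤⇒< filling (λ eq → ℕₚ.<-irrefl (cong (toℕ ∘ column) eq) j<k) (SemistandardPage.rows (pages p) i j k i<j i<k j<k))
      where
      i<j = Finₚ.≤∧≢⇒< i≤j i≢j
      i<k = ℕₚ.<-trans i<j j<k

    columns : ∀ p i k j i≤j k≤j → i Fin.< k → f (page p i j i≤j) < f (page p k j k≤j)
    columns p i k j i≤j k≤j i<k with k Finₚ.≟ j
    ... | yes refl = subst (λ c → f c < f (diag j)) (sym (off-page i≤j i<k)) (proj₂ (IsSelberg.between selberg p i j i<k))
    ... | no k≢j   = subst (λ c → f c < f (off p k j k<j)) (sym (off-page i≤j i<j)) (SemistandardPage.columns (pages p) i k j i<j k<j i<k)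
      where
      k<j = Finₚ.≤∧≢⇒< k≤j k≢j
      i<j = ℕₚ.<-trans i<k k<j

  -- The diagonal is ordered only through the off-diagonal cells between its entries, so some page
  -- must exist.
  Selberg-diagonal-≤ : Fin m → IsSelberg n m f → ∀ i j → i Fin.< j → f (diag i) ≤ f (diag j)
  Selberg-diagonal-≤ p selberg i j i<j = let l , u = IsSelberg.between selberg p i j i<j in ℕₚ.<⇒≤ (ℕₚ.<-trans l u)

  Young⇒Filling : IsYoung n m f → IsFilling n m f
  Young⇒Filling = IsSelberg.isFilling ∘ IsYoung.isSelberg

-- The predicates are kept abstract, up to equivalence, so that the conclusion speaks of exactly the
-- setoids of either claim, with or without a gap component.
Selberg-Young-count : ∀ {n m} → Fin m → (D : DiagonalCondition n) (PS PY : (Cell n m → ℕ) → Set) → (let open DiagonalCondition D) →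
  (∀ {f} → PS f → IsSelberg n m f × Holds (f ∘ diag)) → (∀ {f} → IsSelberg n m f → Holds (f ∘ diag) → PS f) →
  (∀ {f} → PY f → IsYoung n m f × Holds (f ∘ diag)) → (∀ {f} → IsYoung n m f → Holds (f ∘ diag) → PY f) →
  ∃₂ λ (s y : ℕ) → HasCard (Books n m PS) s × HasCard (Books n m PY) y × s ≡ superfactorial n ℕ.^ m ℕ.* y
Selberg-Young-count {n} {m} p D PS PY S⁻ S⁺ Y⁻ Y⁺ = _ , _ ,
  hasCard-books selbergPages PS
    (IsSelberg.isFilling ∘ proj₁ ∘ S⁻) (Selberg-diagonal-≤ p ∘ proj₁ ∘ S⁻) (proj₂ ∘ S⁻) (Selberg⇒Between ∘ proj₁ ∘ S⁻)
    (λ filling holds valid → S⁺ (Between⇒Selberg filling valid) holds) ,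
  hasCard-books youngPages PY
    (Young⇒Filling ∘ proj₁ ∘ Y⁻) (Selberg-diagonal-≤ p ∘ IsYoung.isSelberg ∘ proj₁ ∘ Y⁻) (proj₂ ∘ Y⁻) (Young⇒Semistandard ∘ proj₁ ∘ Y⁻)
    (λ filling holds valid → Y⁺ (Semistandard⇒Young filling valid) holds) ,
  length-books
  where open Enumeration m D

gaps : ∀ n → (Fin (ℕ.pred n) → ℕ) → DiagonalCondition n
gaps n d = record
  { Holds      = λ g → ∀ i → g (upper i) ≡ g (lower i) ℕ.+ d i ℕ.+ 1
  ; holds?     = λ g → Finₚ.all? (λ i → g (upper i) ℕ.≟ g (lower i) ℕ.+ d i ℕ.+ 1)
  ; holds-resp = λ g≗g′ holds i →
      trans (sym (g≗g′ (upper i))) (trans (holds i) (cong (λ v → v ℕ.+ d i ℕ.+ 1) (g≗g′ (lower i))))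
  }

unconditional : ∀ n → DiagonalCondition n
unconditional n = record { Holds = λ _ → ⊤ ; holds? = λ _ → yes tt ; holds-resp = λ _ _ → tt }

open import Data.Nat using (pred; _*_; _^_)

theorem3p5 : (n m : ℕ) → .{{_ : NonZero n}} → .{{_ : NonZero m}} →
    ((d : Fin (pred n) → ℕ) →
    ∃₂ λ (s y : ℕ) → HasCard (SBGaps n m d) s × HasCard (YBGaps n m d) y × s ≡ superfactorial n ^ m * y)
    × (∃₂ λ (s y : ℕ) → HasCard (SB n m) s × HasCard (YB n m) y × s ≡ superfactorial n ^ m * y)
theorem3p5 n zero    = ⊥-elim (ℕ.≢-nonZero⁻¹ 0 refl)
theorem3p5 n (suc m) =
  (λ d → Selberg-Young-count zero (gaps n d) _ _ id _,_ id _,_) ,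
  Selberg-Young-count zero (unconditional n) _ _ (_, tt) (λ selberg _ → selberg) (_, tt) (λ young _ → young)
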